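{- With the notation of the context, $$\lim_{N\rightarrow\infty}\sum_{w\in[0,N]^*}\eta\psi'(w)=\frac{H(r_0Y)(1-t)\prod_{m=1}^{l-1}E(-s_mY)H(r_ms_mY)}{\bigl(1+\sum_{m=1}^{l-1}s_m\bigr)H(tY)-\bigl(t+\sum_{m=1}^{l-1}s_m\bigr)H(Y)},$$ where $H(cY)=\prod_{i\geq0}(1-cY_i)^{ -1}$ and $E(cY)=\prod_{i\geq0}(1+cY_i)$ for a scalar $c$, and the limit is taken coefficientwise in formal power series in $Y_0,Y_1,\dots$.
   Context: Fix $l\ge1$. For $N\ge0$, $[0,N]^*$ is the set of all finite words (including the empty word) over $\{0,1,\dots,N\}$. For a word $w=w_1\cdots w_n$: $i\in[n-1]$ is a decrease of $w$ if $w_i=w_{i+1}=\cdots=w_j>w_{j+1}$ for some $j$ with $i\le j\le n-1$; $\mathrm{DEC}(w)$ is the set of decreases; $\mathrm{INC}(w)=[n]\setminus\mathrm{DEC}(w)$ is the set of increases; $i$ is a record if $w_i\ge w_j$ for all $1\le j<i$, and $\mathrm{REC}(w)$ is the set of records. With commuting variables $\xi_i,\eta_i,\zeta_i$ ($i\ge0$), let $\psi'(w)=\prod_{i\in\mathrm{DEC}(w)}\xi_{w_i}\prod_{i\in\mathrm{INC}(w)\setminus\mathrm{REC}(w)}\eta_{w_i}\prod_{i\in\mathrm{INC}(w)\cap\mathrm{REC}(w)}\zeta_{w_i}$ (so $\psi'(\emptyset)=1$). Let $\eta$ be the ring homomorphism defined by: if $j=li$ with $i\ge0$, then $\xi_j\mapsto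 tY_{i-1}$, $\zeta_j\mapsto r_0Y_i$, $\eta_j\mapsto Y_i$; if $j=li+m$ with $i\ge0$, $1\le m\le l-1$, then $\xi_j\mapsto s_mY_i$, $\zeta_j\mapsto r_ms_mY_i$, $\eta_j\mapsto s_mY_i$. (The variable $\xi_0$ never occurs, since $0$ is never a decrease value.) Here $t,r_0,\dots,r_{l-1},s_1,\dots,s_{l-1},Y_0,Y_1,\dots$ are commuting indeterminates. -}

module Defs where

open import Data.Nat as ℕ using (ℕ; zero; suc; _∸_; _<ᵇ_; _≡ᵇ_; NonZero)
open import Data.Nat.DivMod using (_/_; _%_)
open import Data.Integer as ℤ using (ℤ; 0ℤ; 1ℤ)
open import Data.Bool using (Bool; true; false; if_then_else_; _∧_)
open import Data.List as List using (List; []; _∷_; [_]; _++_; upTo; concatMap; foldr)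
open import Data.Vec as Vec using (Vec; []; _∷_; replicate; tabulate)
import Data.Vec as V
open import Data.Vec.Properties using (≡-dec)
open import Data.Fin using (Fin; toℕ)
open import Data.Product using (_×_; _,_)
open import Relation.Nullary.Decidable using (does)

-- Formal power series over ℤ in finitely many variables.
-- A monomial in n variables is its exponent vector; a series is its
-- coefficient function.

Ser : ℕ → Set
Ser n = Vec ℕ n → ℤ

splits : ∀ {n} → Vec ℕ n → List (Vec ℕ n × Vec ℕ n)
splits [] = [ ([] , []) ]
splits (a ∷ α) =
  concatMap (λ k → List.map (λ { (β , γ) → (k ∷ β , (a ∸ k) ∷ γ) }) (splits α))
            (upTo (suc a))

sumℤ : List ℤ → ℤ
sumℤ = foldr ℤ._+_ 0ℤ

infixl 6 _⊕_ _⊖_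
infixl 7 _⊗_

_⊕_ : ∀ {n} → Ser n → Ser n → Ser n
(f ⊕ g) α = f α ℤ.+ g α

_⊖_ : ∀ {n} → Ser n → Ser n → Ser n
(f ⊖ g) α = f α ℤ.- g α

_⊗_ : ∀ {n} → Ser n → Ser n → Ser n
(f ⊗ g) α = sumℤ (List.map (λ { (β , γ) → f β ℤ.* g γ }) (splits α))

zeroS : ∀ {n} → Ser n
zeroS _ = 0ℤ

mono : ∀ {n} → Vec ℕ n → Ser n
mono e α = if does (≡-dec ℕ._≟_ α e) then 1ℤ else 0ℤ

oneS : ∀ {n} → Ser n
oneS = mono (replicate _ 0)

sumS : ∀ {n} → List (Ser n) → Ser n
sumS = foldr _⊕_ zeroS

prodS : ∀ {n} → List (Ser n) → Ser n
prodS = foldr _⊗_ oneS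

powS : ∀ {n} → Ser n → ℕ → Ser n
powS f zero = oneS
powS f (suc k) = f ⊗ powS f k

deg : ∀ {n} → Vec ℕ n → ℕ
deg = V.foldr _ ℕ._+_ 0

-- multiplicative inverse of a series f with constant term 1:
-- f⁻¹ = Σ_{k ≥ 0} (1 - f)^k ; at a monomial α only k ≤ deg α contribute.
invS : ∀ {n} → Ser n → Ser n
invS f α = sumS (List.map (powS (oneS ⊖ f)) (upTo (suc (deg α)))) α

-- Variables.  For the parameter l and truncation level K the variables
-- are  t, r_0..r_{l-1}, s_1..s_{l-1}, Y_0..Y_{K-1}  (in this order);
-- all Y_i with i ≥ K are set to 0.

NV : ℕ → ℕ → ℕ
NV l K = suc (l ℕ.+ ((l ∸ 1) ℕ.+ K))

Mono : ℕ → ℕ → Set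
Mono l K = Vec ℕ (NV l K)

-- unit vector with a 1 at position i (all zeros if i ≥ m)
unitV : (m : ℕ) → ℕ → Vec ℕ m
unitV m i = tabulate (λ (j : Fin m) → if toℕ j ≡ᵇ i then 1 else 0)

zerosV : (m : ℕ) → Vec ℕ m
zerosV m = replicate m 0

module Vars (l K : ℕ) where

  S' : Set
  S' = Ser (NV l K)

  tV : S'
  tV = mono (1 ∷ zerosV l V.++ zerosV (l ∸ 1) V.++ zerosV K)

  rV : ℕ → S'
  rV m = mono (0 ∷ unitV l m V.++ zerosV (l ∸ 1) V.++ zerosV K)

  sV : ℕ → S'
  sV m = mono (0 ∷ zerosV l V.++ unitV (l ∸ 1) (m ∸ 1) V.++ zerosV K)

  YV : ℕ → S'
  YV i = if i <ᵇ K
           then mono (0 ∷ zerosV l V.++ zerosV (l ∸ 1) V.++ unitV K i)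
           else zeroS

  -- position holding letter a, followed by the letters `rest`, is a
  -- decrease iff a = w_{i+1} = ... = w_j > w_{j+1} for some j
  isDec : ℕ → List ℕ → Bool
  isDec a [] = false
  isDec a (b ∷ rest) =
    if b <ᵇ a then true else (if b ≡ᵇ a then isDec a rest else false)

  isRec : List ℕ → ℕ → Bool
  isRec pre a = foldr (λ b acc → (b ℕ.≤ᵇ a) ∧ acc) true pre

  -- images under the homomorphism η of ξ_j, ζ_j, η_j   (j = l i + m)
  module _ .{{_ : NonZero l}} where

    ξimg : ℕ → S'
    ξimg j with j % l | j / l
    ... | zero  | zero  = zeroS          -- ξ_0 never occurs
    ... | zero  | suc i = tV ⊗ YV i
    ... | suc m | i     = sV (suc m) ⊗ YV i

    ζimg : ℕ → S'
    ζimg j with j % l | j / l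
    ... | zero  | i = rV 0 ⊗ YV i
    ... | suc m | i = rV (suc m) ⊗ sV (suc m) ⊗ YV i

    ηimg : ℕ → S'
    ηimg j with j % l | j / l
    ... | zero  | i = YV i
    ... | suc m | i = sV (suc m) ⊗ YV i

    letterImg : List ℕ → ℕ → List ℕ → S'
    letterImg pre a rest =
      if isDec a rest then ξimg a
      else (if isRec pre a then ζimg a else ηimg a)

    ψimg : List ℕ → List ℕ → S'
    ψimg pre [] = oneS
    ψimg pre (a ∷ rest) = letterImg pre a rest ⊗ ψimg (pre ++ [ a ]) rest

    ηψ' : List ℕ → S'
    ηψ' w = ψimg [] w

  wordsOf : ℕ → ℕ → List (List ℕ)
  wordsOf N zero = [ [] ]
  wordsOf N (suc n) =
    concatMap (λ a → List.map (a ∷_) (wordsOf N n)) (upTo (suc N))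

  wordsUpTo : ℕ → ℕ → List (List ℕ)
  wordsUpTo N L = concatMap (wordsOf N) (upTo (suc L))

  LHS : .{{_ : NonZero l}} → ℕ → ℕ → S'
  LHS N L = sumS (List.map ηψ' (wordsUpTo N L))

  H : S' → S'
  H c = prodS (List.map (λ i → invS (oneS ⊖ c ⊗ YV i)) (upTo K))

  E : S' → S'
  E c = prodS (List.map (λ i → oneS ⊕ c ⊗ YV i) (upTo K))

  ms : List ℕ
  ms = List.map suc (upTo (l ∸ 1))

  sumS-s : S'
  sumS-s = sumS (List.map sV ms)

  numerator : S'
  numerator =
    H (rV 0) ⊗ (oneS ⊖ tV)
      ⊗ prodS (List.map (λ m → E (zeroS ⊖ sV m) ⊗ H (rV m ⊗ sV m)) ms)

  denominator : S'
  denominator = (oneS ⊕ sumS-s) ⊗ H tV ⊖ (tV ⊕ sumS-s) ⊗ H oneS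

  RHS : S'
  RHS = numerator ⊗ invS denominator

{-# OPTIONS --safe #-}
-- Everything is computed modulo series of order greater than d, where only words of length
-- at most d count.  Let T M be the sum of the weights of all words read after a prefix with
-- maximum M, and P M b the part of T M coming from words whose first letter is below b.
-- Removing the first letter yields linear recurrences with solution P M b = (1 - Q b) T M for
-- b ≤ M, where Q 0 = 1 and Q (b + 1) = (1 - η_b) (1 - (1 - Q b) / (1 - ξ_b)).  Comparing words
-- that start with a letter ≥ M, hence with a record, gives (1 - η_M) T (M + 1) = (1 - ζ_M) T M,
-- and therefore
--     Q (N + 1) · T 0 · ∏ (1 - ζ_b) = ∏ (1 - η_b),   b = 0, …, N.
-- For the given images of ξ, η, ζ, a letter with ξ_b = η_b just subtracts η_b from Q; solving the
-- recurrence over the blocks of l consecutive letters turns (1 - t) H(Y) Q (N + 1) into the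
-- denominator of the formula.
module Submission where

open import Defs
open import Algebra using (CommutativeMonoid; CommutativeRing; IsCommutativeRing)
import Algebra.Properties.Ring as RingProperties
import Algebra.Properties.Semiring.Mult.TCOptimised as Mult
import Algebra.Solver.Ring as Solver
open import Algebra.Solver.Ring.AlmostCommutativeRing
  using (fromCommutativeRing; _-Raw-AlmostCommutative⟶_)
open import Data.Bool using (true; false; if_then_else_; _∧_)
open import Data.Bool.Properties using (T-≡; ¬-not)
open import Data.Empty using (⊥-elim)
open import Data.Fin as Fin using (Fin; toℕ; fromℕ<)
open import Data.Fin.Properties using (toℕ-fromℕ<)
open import Data.Integer as ℤ using (ℤ; 0ℤ; 1ℤ)
import Data.Integer.Properties as ℤ
open import Data.List as List using (List; []; _∷_; [_]; _++_; upTo; applyUpTo; concatMap; length)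
import Data.List.Properties as List
open import Data.List.Relation.Unary.All as All using (All; []; _∷_)
import Data.List.Relation.Unary.All.Properties as All
open import Data.Maybe using (Maybe; just; nothing)
open import Data.Nat as ℕ using (ℕ; zero; suc; _≤_; _<_; z≤n; s≤s; _⊔_; NonZero)
open import Data.Nat.DivMod using (_/_; _%_; [m+kn]%n≡m%n; m<n⇒m%n≡m; m*n/n≡m; m<n⇒m/n≡0;
  +-distrib-/-∣ʳ; /-monoˡ-≤; m≡m%n+[m/n]*n)
open import Data.Nat.Divisibility using (divides-refl)
import Data.Nat.Properties as ℕ
open import Data.Product using (_×_; _,_; proj₁; proj₂; ∃-syntax)
open import Data.Vec as Vec using (Vec; []; _∷_; tabulate)
open import Data.Vec.Properties using (≡-dec)
open import Function using (_∘_; id; Equivalence)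
open import Level using (0ℓ)
open import Relation.Binary.PropositionalEquality as ≡ using (_≡_)
import Relation.Binary.Reasoning.Setoid as SetoidReasoning
open import Relation.Nullary using (yes; no)

-- Ring solver with integer coefficients over an arbitrary commutative ring.

module ℤ-Coefficients {c ℓ} (R : CommutativeRing c ℓ) where
  open CommutativeRing R
  open RingProperties ring
  open Mult semiring using (×-homo-+; ×1-homo-*; ×-cong; 1+×) renaming (_×_ to _·_)
  open SetoidReasoning setoid

  open import Data.Integer using (+_; -[1+_])

  private
    ⟦_⟧ : ℤ → Carrier
    ⟦ + n ⟧ = n · 1#
    ⟦ -[1+ n ] ⟧ = - (suc n · 1#)

    cong-⟦⟧ : ∀ {i j} → i ≡ j → ⟦ i ⟧ ≈ ⟦ j ⟧
    cong-⟦⟧ ≡.refl = refl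

    ⟦⟧-neg : ∀ i → ⟦ ℤ.- i ⟧ ≈ - ⟦ i ⟧
    ⟦⟧-neg (+ zero) = sym -0#≈0#
    ⟦⟧-neg (+ suc n) = refl
    ⟦⟧-neg -[1+ n ] = sym (-‿involutive _)

    ⟦⟧-⊖ : ∀ m n → ⟦ m ℤ.⊖ n ⟧ ≈ m · 1# - n · 1#
    ⟦⟧-⊖ m zero = sym (trans (+-congˡ -0#≈0#) (+-identityʳ _))
    ⟦⟧-⊖ zero (suc n) = sym (+-identityˡ _)
    ⟦⟧-⊖ (suc m) (suc n) = begin
      ⟦ suc m ℤ.⊖ suc n ⟧                  ≈⟨ cong-⟦⟧ (ℤ.[1+m]⊖[1+n]≡m⊖n m n) ⟩
      ⟦ m ℤ.⊖ n ⟧                          ≈⟨ ⟦⟧-⊖ m n ⟩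
      m · 1# - n · 1#                      ≈⟨ +-congʳ (+-identityʳ _) ⟨
      (m · 1# + 0#) - n · 1#               ≈⟨ +-congʳ (+-congˡ (-‿inverseʳ 1#)) ⟨
      (m · 1# + (1# - 1#)) - n · 1#        ≈⟨ +-congʳ (+-assoc _ _ _) ⟨
      ((m · 1# + 1#) - 1#) - n · 1#        ≈⟨ +-assoc _ _ _ ⟩
      (m · 1# + 1#) + (- 1# - n · 1#)      ≈⟨ +-cong (+-comm _ _) (-‿+-comm _ _) ⟩
      (1# + m · 1#) - (1# + n · 1#)        ≈⟨ +-cong (1+× m 1#) (-‿cong (1+× n 1#)) ⟨
      suc m · 1# - suc n · 1#              ∎

    ⟦⟧-+ : ∀ i j → ⟦ i ℤ.+ j ⟧ ≈ ⟦ i ⟧ + ⟦ j ⟧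
    ⟦⟧-+ (+ m) (+ n) = ×-homo-+ 1# m n
    ⟦⟧-+ (+ m) -[1+ n ] = ⟦⟧-⊖ m (suc n)
    ⟦⟧-+ -[1+ m ] (+ n) = trans (⟦⟧-⊖ n (suc m)) (+-comm _ _)
    ⟦⟧-+ -[1+ m ] -[1+ n ] = begin
      - (suc (suc (m ℕ.+ n)) · 1#)         ≈⟨ -‿cong (×-cong (≡.cong suc (≡.sym (ℕ.+-suc m n))) refl) ⟩
      - ((suc m ℕ.+ suc n) · 1#)           ≈⟨ -‿cong (×-homo-+ 1# (suc m) (suc n)) ⟩
      - (suc m · 1# + suc n · 1#)          ≈⟨ -‿+-comm _ _ ⟨
      - (suc m · 1#) - suc n · 1#          ∎

    ⟦⟧-*⁺ : ∀ m j → ⟦ + m ℤ.* j ⟧ ≈ m · 1# * ⟦ j ⟧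
    ⟦⟧-*⁺ m (+ n) = trans (cong-⟦⟧ (≡.sym (ℤ.pos-* m n))) (×1-homo-* m n)
    ⟦⟧-*⁺ m -[1+ n ] = begin
      ⟦ + m ℤ.* -[1+ n ] ⟧                 ≈⟨ cong-⟦⟧ (ℤ.neg-distribʳ-* (+ m) (+ suc n)) ⟨
      ⟦ ℤ.- (+ m ℤ.* + suc n) ⟧            ≈⟨ ⟦⟧-neg (+ m ℤ.* + suc n) ⟩
      - ⟦ + m ℤ.* + suc n ⟧                ≈⟨ -‿cong (⟦⟧-*⁺ m (+ suc n)) ⟩
      - (m · 1# * suc n · 1#)              ≈⟨ -‿distribʳ-* _ _ ⟩
      m · 1# * - (suc n · 1#)              ∎

    ⟦⟧-* : ∀ i j → ⟦ i ℤ.* j ⟧ ≈ ⟦ i ⟧ * ⟦ j ⟧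
    ⟦⟧-* (+ m) j = ⟦⟧-*⁺ m j
    ⟦⟧-* -[1+ m ] j = begin
      ⟦ -[1+ m ] ℤ.* j ⟧                   ≈⟨ cong-⟦⟧ (ℤ.neg-distribˡ-* (+ suc m) j) ⟨
      ⟦ ℤ.- (+ suc m ℤ.* j) ⟧              ≈⟨ ⟦⟧-neg (+ suc m ℤ.* j) ⟩
      - ⟦ + suc m ℤ.* j ⟧                  ≈⟨ -‿cong (⟦⟧-*⁺ (suc m) j) ⟩
      - (suc m · 1# * ⟦ j ⟧)               ≈⟨ -‿distribˡ-* _ _ ⟩
      - (suc m · 1#) * ⟦ j ⟧               ∎

    coefficients : ℤ.+-*-rawRing -Raw-AlmostCommutative⟶ fromCommutativeRing R
    coefficients = record
      { ⟦_⟧ = ⟦_⟧ ; +-homo = ⟦⟧-+ ; *-homo = ⟦⟧-* ; -‿homo = ⟦⟧-neg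
      ; 0-homo = refl ; 1-homo = refl }

    _≟_ : ∀ i j → Maybe (⟦ i ⟧ ≈ ⟦ j ⟧)
    i ≟ j with i ℤ.≟ j
    ... | yes ≡.refl = just refl
    ... | no _ = nothing

  open Solver ℤ.+-*-rawRing (fromCommutativeRing R) coefficients _≟_ public
    using (solve; _:=_; _:+_; _:*_; _:-_; :-_; con; Polynomial)

  :1 : ∀ {n} → Polynomial n
  :1 = con 1ℤ

-- Finite sums and products over a commutative monoid.

module Iteration {c ℓ} (M : CommutativeMonoid c ℓ) where
  open CommutativeMonoid M
  open SetoidReasoning setoid

  ⨁ : ℕ → (ℕ → Carrier) → Carrier
  ⨁ zero f = ε
  ⨁ (suc n) f = ⨁ n f ∙ f n

  ⨁-cong : ∀ n {f g} → (∀ k → k < n → f k ≈ g k) → ⨁ n f ≈ ⨁ n g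
  ⨁-cong zero eq = refl
  ⨁-cong (suc n) eq = ∙-cong (⨁-cong n λ k k<n → eq k (ℕ.m<n⇒m<1+n k<n)) (eq n ℕ.≤-refl)

  ⨁-ε : ∀ n {f} → (∀ k → k < n → f k ≈ ε) → ⨁ n f ≈ ε
  ⨁-ε zero eq = refl
  ⨁-ε (suc n) eq =
    trans (∙-cong (⨁-ε n λ k k<n → eq k (ℕ.m<n⇒m<1+n k<n)) (eq n ℕ.≤-refl)) (identityˡ ε)

  ⨁-stable : ∀ {j m} f → j ℕ.≤′ m → (∀ k → j ≤ k → f k ≈ ε) → ⨁ m f ≈ ⨁ j f
  ⨁-stable f ℕ.≤′-refl eq = refl
  ⨁-stable f (ℕ.≤′-step j≤m) eq =
    trans (∙-cong (⨁-stable f j≤m eq) (eq _ (ℕ.≤′⇒≤ j≤m))) (identityʳ _)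

  interchange : ∀ a b c d → (a ∙ b) ∙ (c ∙ d) ≈ (a ∙ c) ∙ (b ∙ d)
  interchange a b c d = begin
    (a ∙ b) ∙ (c ∙ d)  ≈⟨ assoc _ _ _ ⟩
    a ∙ (b ∙ (c ∙ d))  ≈⟨ ∙-congˡ (assoc _ _ _) ⟨
    a ∙ ((b ∙ c) ∙ d)  ≈⟨ ∙-congˡ (∙-congʳ (comm _ _)) ⟩
    a ∙ ((c ∙ b) ∙ d)  ≈⟨ ∙-congˡ (assoc _ _ _) ⟩
    a ∙ (c ∙ (b ∙ d))  ≈⟨ assoc _ _ _ ⟨
    (a ∙ c) ∙ (b ∙ d)  ∎

  ⨁-∙ : ∀ n f g → ⨁ n (λ k → f k ∙ g k) ≈ ⨁ n f ∙ ⨁ n g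
  ⨁-∙ zero f g = sym (identityˡ ε)
  ⨁-∙ (suc n) f g = trans (∙-congʳ (⨁-∙ n f g)) (interchange _ _ _ _)

  ⨁-swap : ∀ m n (f : ℕ → ℕ → Carrier) →
    ⨁ m (λ i → ⨁ n (f i)) ≈ ⨁ n (λ j → ⨁ m (λ i → f i j))
  ⨁-swap zero n f = sym (⨁-ε n λ _ _ → refl)
  ⨁-swap (suc m) n f =
    trans (∙-congʳ (⨁-swap m n f)) (sym (⨁-∙ n (λ j → ⨁ m (λ i → f i j)) (f m)))

  ⨁-front : ∀ n f → ⨁ (suc n) f ≈ f 0 ∙ ⨁ n (f ∘ suc)
  ⨁-front zero f = comm _ _
  ⨁-front (suc n) f = trans (∙-congʳ (⨁-front n f)) (assoc _ _ _)

  ⨁-+ : ∀ m k f → ⨁ (m ℕ.+ k) f ≈ ⨁ k f ∙ ⨁ m (λ j → f (j ℕ.+ k))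
  ⨁-+ zero k f = sym (identityʳ _)
  ⨁-+ (suc m) k f = trans (∙-congʳ (⨁-+ m k f)) (assoc _ _ _)

  ⨁-blocks : ∀ l i f → ⨁ (i ℕ.* l) f ≈ ⨁ i (λ j → ⨁ l (λ m → f (m ℕ.+ j ℕ.* l)))
  ⨁-blocks l zero f = refl
  ⨁-blocks l (suc i) f = trans (⨁-+ l (i ℕ.* l) f) (∙-congʳ (⨁-blocks l i f))

  -- With subtraction this would say that the partial sums of `f` and `g` differ by the same amount
  -- at `m` and at `n`; the crosswise form makes sense in any commutative monoid.
  ⨁-tail-swap : ∀ {m n} f g → m ℕ.≤′ n → (∀ k → m ≤ k → f k ≈ g k) →
    ⨁ n f ∙ ⨁ m g ≈ ⨁ n g ∙ ⨁ m f
  ⨁-tail-swap f g ℕ.≤′-refl eq = comm _ _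
  ⨁-tail-swap {m} f g (ℕ.≤′-step {n} m≤n) eq = begin
    (⨁ n f ∙ f n) ∙ ⨁ m g  ≈⟨ rotate _ _ _ ⟩
    (⨁ n f ∙ ⨁ m g) ∙ f n  ≈⟨ ∙-cong (⨁-tail-swap f g m≤n eq) (eq n (ℕ.≤′⇒≤ m≤n)) ⟩
    (⨁ n g ∙ ⨁ m f) ∙ g n  ≈⟨ rotate _ _ _ ⟩
    (⨁ n g ∙ g n) ∙ ⨁ m f  ∎
    where
    rotate : ∀ a b c → (a ∙ b) ∙ c ≈ (a ∙ c) ∙ b
    rotate a b c = trans (assoc _ _ _) (trans (∙-congˡ (comm _ _)) (sym (assoc _ _ _)))

  module _ {a} {A : Set a} (g : A → Carrier) where

    fold : List A → Carrier
    fold xs = List.foldr _∙_ ε (List.map g xs)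

    fold-++ : ∀ xs ys → fold (xs ++ ys) ≈ fold xs ∙ fold ys
    fold-++ [] ys = sym (identityˡ _)
    fold-++ (x ∷ xs) ys = trans (∙-congˡ (fold-++ xs ys)) (sym (assoc _ _ _))

    fold-applyUpTo : ∀ n f → fold (applyUpTo f n) ≈ ⨁ n (g ∘ f)
    fold-applyUpTo zero f = refl
    fold-applyUpTo (suc n) f =
      trans (∙-congˡ (fold-applyUpTo n (f ∘ suc))) (sym (⨁-front n (g ∘ f)))

    fold-concatMap : ∀ (h : ℕ → List A) n →
      fold (concatMap h (upTo n)) ≈ ⨁ n (λ k → fold (h k))
    fold-concatMap h n = go n id
      where
      go : ∀ n f → fold (concatMap h (applyUpTo f n)) ≈ ⨁ n (λ k → fold (h (f k)))
      go zero f = refl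
      go (suc n) f = trans (fold-++ (h (f 0)) _)
        (trans (∙-congˡ (go n (f ∘ suc))) (sym (⨁-front n _)))

  fold-map : ∀ {a b} {A : Set a} {B : Set b} (g : B → Carrier) (h : A → B) xs →
    fold g (List.map h xs) ≡ fold (g ∘ h) xs
  fold-map g h xs = ≡.cong (List.foldr _∙_ ε) (≡.sym (List.map-∘ xs))

-- Units and cancellation in a commutative ring.

module Units {c ℓ} (R : CommutativeRing c ℓ) where
  open CommutativeRing R
  open SetoidReasoning setoid
  open ℤ-Coefficients R
  open Iteration +-commutativeMonoid using (⨁)

  x-0≈x : ∀ x → x - 0# ≈ x
  x-0≈x = solve 1 (λ x → x :- con 0ℤ := x) refl

  one⇒1-a≈0 : ∀ {a} → a ≈ 1# → 1# - a ≈ 0#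
  one⇒1-a≈0 eq = trans (+-congˡ (-‿cong eq)) (-‿inverseʳ 1#)

  zero⇒1-a≈1 : ∀ {a} → a ≈ 0# → 1# - a ≈ 1#
  zero⇒1-a≈1 eq = trans (+-congˡ (-‿cong eq)) (x-0≈x 1#)

  multiple≈0 : ∀ a {b} → b ≈ 0# → a * b ≈ 0#
  multiple≈0 a eq = trans (*-congˡ eq) (zeroʳ a)

  inverse≈1 : ∀ {a v} → a ≈ 1# → a * v ≈ 1# → v ≈ 1#
  inverse≈1 eq inv = trans (sym (*-identityˡ _)) (trans (*-congʳ (sym eq)) inv)

  cancel : ∀ u i → u * i ≈ 1# → ∀ {x y} → u * x ≈ u * y → x ≈ y
  cancel u i inv {x} {y} eq = begin
    x            ≈⟨ *-identityˡ x ⟨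
    1# * x       ≈⟨ *-congʳ inv ⟨
    u * i * x    ≈⟨ solve 3 (λ u i x → u :* i :* x := i :* (u :* x)) refl u i x ⟩
    i * (u * x)  ≈⟨ *-congˡ eq ⟩
    i * (u * y)  ≈⟨ solve 3 (λ u i x → u :* i :* x := i :* (u :* x)) refl u i y ⟨
    u * i * y    ≈⟨ *-congʳ inv ⟩
    1# * y       ≈⟨ *-identityˡ y ⟩
    y            ∎

  divide : ∀ x n u i → u * i ≈ 1# → x * u ≈ n → x ≈ n * i
  divide x n u i inv eq = begin
    x            ≈⟨ *-identityʳ x ⟨
    x * 1#       ≈⟨ *-congˡ inv ⟨
    x * (u * i)  ≈⟨ *-assoc x u i ⟨
    x * u * i    ≈⟨ *-congʳ eq ⟩
    n * i        ∎

  Q-step≈1 : ∀ {e v q} → e ≈ 0# → v ≈ 1# → q ≈ 1# → (1# - e) * (1# - v * (1# - q)) ≈ 1#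
  Q-step≈1 {e} {v} {q} e≈0 v≈1 q≈1 = begin
    (1# - e) * (1# - v * (1# - q))
      ≈⟨ *-cong (+-congˡ (-‿cong e≈0))
           (+-congˡ (-‿cong (*-cong v≈1 (+-congˡ (-‿cong q≈1))))) ⟩
    (1# - 0#) * (1# - 1# * (1# - 1#))
      ≈⟨ solve 0 ((:1 :- con 0ℤ) :* (:1 :- :1 :* (:1 :- :1)) := :1) refl ⟩
    1# ∎

  denominator≈1 : ∀ {s t g h} → t ≈ 0# → g ≈ 1# → h ≈ 1# → (1# + s) * g - (t + s) * h ≈ 1#
  denominator≈1 {s} {t} {g} {h} t≈0 g≈1 h≈1 = begin
    (1# + s) * g - (t + s) * h
      ≈⟨ +-cong (*-congˡ g≈1) (-‿cong (*-cong (+-congʳ t≈0) h≈1)) ⟩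
    (1# + s) * 1# - (0# + s) * 1#
      ≈⟨ solve 1 (λ s → (:1 :+ s) :* :1 :- (con 0ℤ :+ s) :* :1 := :1) refl s ⟩
    1# ∎

  -- Telescoping: `p k` is the `k`-th power of 1 - f, and f times it is `p k` minus `p (suc k)`.
  geometric-sum : ∀ f (p : ℕ → Carrier) → p 0 ≈ 1# → (∀ k → p (suc k) ≈ (1# - f) * p k) →
    ∀ m → f * ⨁ m p ≈ 1# - p m
  geometric-sum f p p₀ p₊ zero = begin
    f * 0#    ≈⟨ solve 1 (λ f → f :* con 0ℤ := :1 :- :1) refl f ⟩
    1# - 1#   ≈⟨ +-congˡ (-‿cong p₀) ⟨
    1# - p 0  ∎
  geometric-sum f p p₀ p₊ (suc m) = begin
    f * (⨁ m p + p m)        ≈⟨ distribˡ _ _ _ ⟩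
    f * ⨁ m p + f * p m      ≈⟨ +-congʳ (geometric-sum f p p₀ p₊ m) ⟩
    (1# - p m) + f * p m     ≈⟨ solve 2 (λ f p → (:1 :- p) :+ f :* p := :1 :- (:1 :- f) :* p)
                                  refl f (p m) ⟩
    1# - (1# - f) * p m      ≈⟨ +-congˡ (-‿cong (p₊ m)) ⟨
    1# - p (suc m)           ∎

-- Formal power series

module Convolution {c ℓ} (R : CommutativeRing c ℓ) where
  open CommutativeRing R
  open SetoidReasoning setoid
  open ℤ-Coefficients R

  -- The Cauchy product, unrolled along its first argument so that the ring laws follow by
  -- structural recursion, with no index subtraction.
  conv : (ℕ → Carrier) → (ℕ → Carrier) → ℕ → Carrier
  conv f g zero = f 0 * g 0
  conv f g (suc n) = f 0 * g (suc n) + conv (f ∘ suc) g n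

  conv-sum : ∀ f g n → List.foldr _+_ 0# (applyUpTo (λ k → f k * g (n ℕ.∸ k)) (suc n)) ≈ conv f g n
  conv-sum f g zero = +-identityʳ _
  conv-sum f g (suc n) = +-congˡ (conv-sum (f ∘ suc) g n)

  conv-cong : ∀ {f f′ g g′} → (∀ k → f k ≈ f′ k) → (∀ k → g k ≈ g′ k) →
    ∀ n → conv f g n ≈ conv f′ g′ n
  conv-cong p q zero = *-cong (p 0) (q 0)
  conv-cong p q (suc n) = +-cong (*-cong (p 0) (q (suc n))) (conv-cong (p ∘ suc) q n)

  conv-distribʳ : ∀ h f g n → conv (λ k → f k + g k) h n ≈ conv f h n + conv g h n
  conv-distribʳ h f g zero = distribʳ _ _ _
  conv-distribʳ h f g (suc n) = begin
    (f 0 + g 0) * h (suc n) + conv (λ k → f (suc k) + g (suc k)) h n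
      ≈⟨ +-congˡ (conv-distribʳ h (f ∘ suc) (g ∘ suc) n) ⟩
    (f 0 + g 0) * h (suc n) + (conv (f ∘ suc) h n + conv (g ∘ suc) h n)
      ≈⟨ solve 5 (λ a b x y z → (a :+ b) :* x :+ (y :+ z) := (a :* x :+ y) :+ (b :* x :+ z))
           refl (f 0) (g 0) (h (suc n)) (conv (f ∘ suc) h n) (conv (g ∘ suc) h n) ⟩
    conv f h (suc n) + conv g h (suc n) ∎

  conv-scaleˡ : ∀ a f g n → conv (λ k → a * f k) g n ≈ a * conv f g n
  conv-scaleˡ a f g zero = *-assoc _ _ _
  conv-scaleˡ a f g (suc n) =
    trans (+-cong (*-assoc _ _ _) (conv-scaleˡ a (f ∘ suc) g n)) (sym (distribˡ _ _ _))

  -- The tail of `conv f g` is `f 0` times the tail of `g` plus `conv (f ∘ suc) g`; linearity in the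
  -- first argument then leaves the induction hypothesis for `f ∘ suc`.
  conv-assoc : ∀ f g h n → conv (conv f g) h n ≈ conv f (conv g h) n
  conv-assoc f g h zero = *-assoc _ _ _
  conv-assoc f g h (suc n) = begin
    f 0 * g 0 * h (suc n) + conv (λ k → f 0 * g (suc k) + conv (f ∘ suc) g k) h n
      ≈⟨ +-congˡ (conv-distribʳ h _ _ n) ⟩
    f 0 * g 0 * h (suc n) + (conv (λ k → f 0 * g (suc k)) h n + conv (conv (f ∘ suc) g) h n)
      ≈⟨ +-congˡ (+-cong (conv-scaleˡ (f 0) (g ∘ suc) h n) (conv-assoc (f ∘ suc) g h n)) ⟩
    f 0 * g 0 * h (suc n) + (f 0 * conv (g ∘ suc) h n + conv (f ∘ suc) (conv g h) n)
      ≈⟨ solve 5 (λ a b x y z → a :* b :* x :+ (a :* y :+ z) := a :* (b :* x :+ y) :+ z)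
           refl (f 0) (g 0) (h (suc n)) (conv (g ∘ suc) h n) (conv (f ∘ suc) (conv g h) n) ⟩
    conv f (conv g h) (suc n) ∎

  -- `conv` peels off terms at the end where `f` has index 0; the induction for `conv-comm`
  -- exchanges the arguments and has to peel at the other end.
  conv-back : ∀ f g n → conv f g (suc n) ≈ f (suc n) * g 0 + conv f (g ∘ suc) n
  conv-back f g zero = +-comm _ _
  conv-back f g (suc n) = begin
    f 0 * g (suc (suc n)) + conv (f ∘ suc) g (suc n)
      ≈⟨ +-congˡ (conv-back (f ∘ suc) g n) ⟩
    f 0 * g (suc (suc n)) + (f (suc (suc n)) * g 0 + conv (f ∘ suc) (g ∘ suc) n)
      ≈⟨ solve 3 (λ x y z → x :+ (y :+ z) := y :+ (x :+ z)) refl _ _ _ ⟩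
    f (suc (suc n)) * g 0 + conv f (g ∘ suc) (suc n) ∎

  conv-comm : ∀ f g n → conv f g n ≈ conv g f n
  conv-comm f g zero = *-comm _ _
  conv-comm f g (suc n) = begin
    f 0 * g (suc n) + conv (f ∘ suc) g n  ≈⟨ +-cong (*-comm _ _) (conv-comm (f ∘ suc) g n) ⟩
    g (suc n) * f 0 + conv g (f ∘ suc) n  ≈⟨ conv-back g f n ⟨
    conv g f (suc n)                      ∎

  conv-zeroˡ : ∀ {f} g → (∀ k → f k ≈ 0#) → ∀ n → conv f g n ≈ 0#
  conv-zeroˡ g p zero = trans (*-congʳ (p 0)) (zeroˡ _)
  conv-zeroˡ g p (suc n) =
    trans (+-cong (trans (*-congʳ (p 0)) (zeroˡ _)) (conv-zeroˡ g (p ∘ suc) n)) (+-identityˡ _)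

  conv-identityˡ : ∀ {f} g → f 0 ≈ 1# → (∀ k → f (suc k) ≈ 0#) → ∀ n → conv f g n ≈ g n
  conv-identityˡ g p q zero = trans (*-congʳ p) (*-identityˡ _)
  conv-identityˡ g p q (suc n) =
    trans (+-cong (trans (*-congʳ p) (*-identityˡ _)) (conv-zeroˡ g q n)) (+-identityʳ _)

infix 4 _≋_ _≈[_]_

-- A record rather than a bare pointwise equality, so that both series can be inferred from the
-- type.
record _≋_ {n} (f g : Ser n) : Set where
  constructor mk≋
  field at : ∀ α → f α ≡ g α

negS : ∀ {n} → Ser n → Ser n
negS f α = ℤ.- f α

module ℤ-Sum = Iteration ℤ.+-0-commutativeMonoid

slice : ∀ {n} → Ser (suc n) → ℕ → Ser n
slice f k α = f (k ∷ α)

IsSerRing : ℕ → Set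
IsSerRing n = IsCommutativeRing (_≋_ {n}) _⊕_ _⊗_ negS zeroS oneS

serRing : ∀ {n} → IsSerRing n → CommutativeRing 0ℓ 0ℓ
serRing isR = record { isCommutativeRing = isR }

sumS-at : ∀ {n} (fs : List (Ser n)) α → sumS fs α ≡ sumℤ (List.map (λ f → f α) fs)
sumS-at [] α = ≡.refl
sumS-at (f ∷ fs) α = ≡.cong (ℤ._+_ (f α)) (sumS-at fs α)

sumℤ-splits : ∀ {n} (φ : Vec ℕ (suc n) × Vec ℕ (suc n) → ℤ) a α →
  sumℤ (List.map φ (splits (a ∷ α))) ≡
  ℤ-Sum.⨁ (suc a) (λ k → sumℤ (List.map (λ (β , γ) → φ (k ∷ β , (a ℕ.∸ k) ∷ γ)) (splits α)))
sumℤ-splits {n} φ a α = begin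
  sumℤ (List.map φ (splits (a ∷ α)))
    -- The pattern-matching lambda in `splits` and `pair k` are different terms that agree on every
    -- pair.
    ≡⟨ ≡.cong (λ xs → sumℤ (List.map φ xs))
         (List.concatMap-cong (λ k → List.map-cong (λ _ → ≡.refl) (splits α)) (upTo (suc a))) ⟩
  ℤ-Sum.fold φ (concatMap (λ k → List.map (pair k) (splits α)) (upTo (suc a)))
    ≡⟨ ℤ-Sum.fold-concatMap φ (λ k → List.map (pair k) (splits α)) (suc a) ⟩
  ℤ-Sum.⨁ (suc a) (λ k → ℤ-Sum.fold φ (List.map (pair k) (splits α)))
    ≡⟨ ℤ-Sum.⨁-cong (suc a) (λ k _ → ℤ-Sum.fold-map φ (pair k) (splits α)) ⟩
  ℤ-Sum.⨁ (suc a) (λ k → sumℤ (List.map (φ ∘ pair k) (splits α))) ∎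
  where
  open ≡.≡-Reasoning
  pair : ℕ → Vec ℕ n × Vec ℕ n → Vec ℕ (suc n) × Vec ℕ (suc n)
  pair k (β , γ) = k ∷ β , (a ℕ.∸ k) ∷ γ

-- For a fixed exponent `k` of the first variable, splitting the other exponents gives a product of
-- two slices; summing over `k` is a convolution over the ring of series in one variable fewer.
⊗-slices : ∀ {n} (isR : IsSerRing n) (f g : Ser (suc n)) a α →
  (f ⊗ g) (a ∷ α) ≡ Convolution.conv (serRing isR) (slice f) (slice g) a α
⊗-slices {n} isR f g a α = begin
  (f ⊗ g) (a ∷ α)
    ≡⟨ sumℤ-splits _ a α ⟩
  ℤ-Sum.⨁ (suc a) (λ k → term k α)
    ≡⟨ ℤ-Sum.fold-applyUpTo (λ k → term k α) (suc a) id ⟨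
  sumℤ (List.map (λ k → term k α) (upTo (suc a)))
    ≡⟨ ≡.cong sumℤ (≡.trans (List.map-upTo (λ k → term k α) (suc a))
         (≡.sym (List.map-applyUpTo term (λ f → f α) (suc a)))) ⟩
  sumℤ (List.map (λ f → f α) (applyUpTo term (suc a)))
    ≡⟨ sumS-at (applyUpTo term (suc a)) α ⟨
  sumS (applyUpTo term (suc a)) α
    ≡⟨ _≋_.at (Convolution.conv-sum (serRing isR) (slice f) (slice g) a) α ⟩
  Convolution.conv (serRing isR) (slice f) (slice g) a α ∎
  where
  open ≡.≡-Reasoning
  term : ℕ → Ser n
  term k = slice f k ⊗ slice g (a ℕ.∸ k)

-- Addition is pointwise, so its laws come from ℤ; commutativity of `⊗` supplies the right identity
-- and left distributivity.
isSerRing-from : ∀ {n} →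
  (∀ {f f′ g g′ : Ser n} → f ≋ f′ → g ≋ g′ → f ⊗ g ≋ f′ ⊗ g′) →
  (∀ (f g h : Ser n) → (f ⊗ g) ⊗ h ≋ f ⊗ (g ⊗ h)) →
  (∀ (f g : Ser n) → f ⊗ g ≋ g ⊗ f) →
  (∀ (f : Ser n) → oneS ⊗ f ≋ f) →
  (∀ (h f g : Ser n) → (f ⊕ g) ⊗ h ≋ (f ⊗ h) ⊕ (g ⊗ h)) →
  IsSerRing n
isSerRing-from ⊗-cong ⊗-assoc ⊗-comm ⊗-identityˡ ⊗-distribʳ = record
  { isRing = record
    { +-isAbelianGroup = record
      { isGroup = record
        { isMonoid = record
          { isSemigroup = record
            { isMagma = record
              { isEquivalence = record
                { refl = mk≋ λ _ → ≡.refl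
                ; sym = λ (mk≋ p) → mk≋ λ α → ≡.sym (p α)
                ; trans = λ (mk≋ p) (mk≋ q) → mk≋ λ α → ≡.trans (p α) (q α) }
              ; ∙-cong = λ (mk≋ p) (mk≋ q) → mk≋ λ α → ≡.cong₂ ℤ._+_ (p α) (q α) }
            ; assoc = λ f g h → mk≋ λ α → ℤ.+-assoc (f α) (g α) (h α) }
          ; identity = (λ f → mk≋ λ α → ℤ.+-identityˡ (f α))
                     , (λ f → mk≋ λ α → ℤ.+-identityʳ (f α)) }
        ; inverse = (λ f → mk≋ λ α → ℤ.+-inverseˡ (f α))
                  , (λ f → mk≋ λ α → ℤ.+-inverseʳ (f α))
        ; ⁻¹-cong = λ (mk≋ p) → mk≋ λ α → ≡.cong ℤ.-_ (p α) }
      ; comm = λ f g → mk≋ λ α → ℤ.+-comm (f α) (g α) }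
    ; *-cong = ⊗-cong
    ; *-assoc = ⊗-assoc
    ; *-identity = ⊗-identityˡ , λ f → ⊗-comm f oneS ⟫ ⊗-identityˡ f
    ; distrib = (λ h f g → ⊗-comm h (f ⊕ g) ⟫ (⊗-distribʳ h f g ⟫
                  mk≋ λ α → ≡.cong₂ ℤ._+_ (_≋_.at (⊗-comm f h) α) (_≋_.at (⊗-comm g h) α)))
              , ⊗-distribʳ }
  ; *-comm = ⊗-comm }
  where
  _⟫_ : ∀ {n} {f g h : Ser n} → f ≋ g → g ≋ h → f ≋ h
  mk≋ p ⟫ mk≋ q = mk≋ λ α → ≡.trans (p α) (q α)

-- A series in n + 1 variables is a sequence of series in n variables, and ⊗ is then
-- the Cauchy product of sequences.
isSerRing : ∀ n → IsSerRing n
isSerRing zero = isSerRing-from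
  -- Without variables the only split is `([] , [])`, so `⊗` is integer multiplication followed by
  -- the `+ 0ℤ` of the empty fold.
  (λ (mk≋ p) (mk≋ q) → mk≋ λ { [] → ≡.cong (ℤ._+ 0ℤ) (≡.cong₂ ℤ._*_ (p []) (q [])) })
  (λ f g h → mk≋ λ { [] → ≡.cong (ℤ._+ 0ℤ) (assoc₀ (f []) (g []) (h [])) })
  (λ f g → mk≋ λ { [] → ≡.cong (ℤ._+ 0ℤ) (ℤ.*-comm (f []) (g [])) })
  (λ f → mk≋ λ { [] → ≡.trans (ℤ.+-identityʳ _) (ℤ.*-identityˡ (f [])) })
  (λ h f g → mk≋ λ { [] → distrib₀ (h []) (f []) (g []) })
  where
  assoc₀ : ∀ x y z → (x ℤ.* y ℤ.+ 0ℤ) ℤ.* z ≡ x ℤ.* (y ℤ.* z ℤ.+ 0ℤ)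
  assoc₀ x y z = ≡.trans (≡.cong (ℤ._* z) (ℤ.+-identityʳ (x ℤ.* y)))
    (≡.trans (ℤ.*-assoc x y z) (≡.cong (x ℤ.*_) (≡.sym (ℤ.+-identityʳ (y ℤ.* z)))))
  distrib₀ : ∀ z x y → (x ℤ.+ y) ℤ.* z ℤ.+ 0ℤ ≡ (x ℤ.* z ℤ.+ 0ℤ) ℤ.+ (y ℤ.* z ℤ.+ 0ℤ)
  distrib₀ z x y = ≡.trans (ℤ.+-identityʳ ((x ℤ.+ y) ℤ.* z)) (≡.trans (ℤ.*-distribʳ-+ z x y)
    (≡.cong₂ ℤ._+_ (≡.sym (ℤ.+-identityʳ (x ℤ.* z))) (≡.sym (ℤ.+-identityʳ (y ℤ.* z)))))
isSerRing (suc n) = isSerRing-from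
  (λ {f} {f′} {g} {g′} (mk≋ p) (mk≋ q) → mk≋ λ { (a ∷ α) →
    slices f g a α ∙ _≋_.at (conv-cong (λ k → mk≋ λ α → p (k ∷ α)) (λ k → mk≋ λ α → q (k ∷ α)) a) α
    ∙ ≡.sym (slices f′ g′ a α) })
  (λ f g h → mk≋ λ { (a ∷ α) →
    slices (f ⊗ g) h a α
    ∙ _≋_.at (conv-cong {g = slice h} (λ k → mk≋ (slices f g k)) (λ _ → refl) a) α
    ∙ _≋_.at (conv-assoc (slice f) (slice g) (slice h) a) α
    ∙ _≋_.at (conv-cong {f = slice f} (λ _ → refl) (λ k → mk≋ λ β → ≡.sym (slices g h k β)) a) α
    ∙ ≡.sym (slices f (g ⊗ h) a α) })
  (λ f g → mk≋ λ { (a ∷ α) →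
    slices f g a α ∙ _≋_.at (conv-comm (slice f) (slice g) a) α ∙ ≡.sym (slices g f a α) })
  (λ f → mk≋ λ { (a ∷ α) →
    slices oneS f a α
    ∙ _≋_.at (conv-identityˡ {slice oneS} (slice f) (mk≋ λ _ → ≡.refl) (λ k → mk≋ λ _ → ≡.refl) a) α })
  (λ h f g → mk≋ λ { (a ∷ α) →
    slices (f ⊕ g) h a α
    ∙ _≋_.at (conv-distribʳ (slice h) (slice f) (slice g) a) α
    ∙ ≡.sym (≡.cong₂ ℤ._+_ (slices f h a α) (slices g h a α)) })
  where
  open Convolution (serRing (isSerRing n))
  open CommutativeRing (serRing (isSerRing n)) using (refl)
  slices : ∀ f g a α → (f ⊗ g) (a ∷ α) ≡ conv (slice f) (slice g) a α
  slices = ⊗-slices (isSerRing n)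
  infixr 5 _∙_
  _∙_ : ∀ {x y z : ℤ} → x ≡ y → y ≡ z → x ≡ z
  _∙_ = ≡.trans

-- Truncation by total degree, orders and inverses.

record _≈[_]_ {n} (f : Ser n) (d : ℕ) (g : Ser n) : Set where
  constructor mk≈
  field at : ∀ α → deg α ≤ d → f α ≡ g α

splits-deg : ∀ {n} (α : Vec ℕ n) → All (λ (β , γ) → deg β ℕ.+ deg γ ≡ deg α) (splits α)
splits-deg [] = ≡.refl ∷ []
splits-deg (a ∷ α) = All.concat⁺ (All.map⁺ (All.applyUpTo⁺₁ id (suc a) λ {k} k≤a →
  All.map⁺ (All.map (λ {p} → add k (ℕ.≤-pred k≤a) (proj₁ p) (proj₂ p)) (splits-deg α))))
  where
  open ≡.≡-Reasoning
  add : ∀ k → k ≤ a → ∀ β γ → deg β ℕ.+ deg γ ≡ deg α →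
    (k ℕ.+ deg β) ℕ.+ (a ℕ.∸ k ℕ.+ deg γ) ≡ a ℕ.+ deg α
  add k k≤a β γ eq = begin
    (k ℕ.+ deg β) ℕ.+ (a ℕ.∸ k ℕ.+ deg γ)  ≡⟨ Nat.interchange k (deg β) (a ℕ.∸ k) (deg γ) ⟩
    (k ℕ.+ (a ℕ.∸ k)) ℕ.+ (deg β ℕ.+ deg γ)  ≡⟨ ≡.cong₂ ℕ._+_ (ℕ.m+[n∸m]≡n k≤a) eq ⟩
    a ℕ.+ deg α ∎
    where module Nat = Iteration ℕ.+-0-commutativeMonoid

sumℤ-cong : ∀ {a} {A : Set a} {P : A → Set} {f g : A → ℤ} → (∀ {x} → P x → f x ≡ g x) →
  ∀ {xs} → All P xs → sumℤ (List.map f xs) ≡ sumℤ (List.map g xs)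
sumℤ-cong eq [] = ≡.refl
sumℤ-cong eq (p ∷ ps) = ≡.cong₂ ℤ._+_ (eq p) (sumℤ-cong eq ps)

sumℤ-zero : ∀ {a} {A : Set a} {P : A → Set} {f : A → ℤ} → (∀ {x} → P x → f x ≡ 0ℤ) →
  ∀ {xs} → All P xs → sumℤ (List.map f xs) ≡ 0ℤ
sumℤ-zero eq [] = ≡.refl
sumℤ-zero eq (p ∷ ps) = ≡.cong₂ ℤ._+_ (eq p) (sumℤ-zero eq ps)

-- Both parts of a split of `α` have degree at most `deg α`, so the coefficients of a product up to
-- degree `d` see only those of its factors up to degree `d`.
⊗-cong[] : ∀ {n d} {f f′ g g′ : Ser n} → f ≈[ d ] f′ → g ≈[ d ] g′ → f ⊗ g ≈[ d ] f′ ⊗ g′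
⊗-cong[] (mk≈ p) (mk≈ q) = mk≈ λ α α≤d → sumℤ-cong
  (λ {(β , γ)} eq → ≡.cong₂ ℤ._*_
    (p β (ℕ.≤-trans (ℕ.m≤m+n _ _) (ℕ.≤-trans (ℕ.≤-reflexive eq) α≤d)))
    (q γ (ℕ.≤-trans (ℕ.m≤n+m _ _) (ℕ.≤-trans (ℕ.≤-reflexive eq) α≤d))))
  (splits-deg α)

-- The quotient ring keeps the carrier `Ser n` and only coarsens equality; the ring identities are
-- inherited from `isSerRing`.
truncated : ℕ → ℕ → CommutativeRing 0ℓ 0ℓ
truncated n d = record
  { Carrier = Ser n ; _≈_ = _≈[ d ]_ ; _+_ = _⊕_ ; _*_ = _⊗_ ; -_ = negS ; 0# = zeroS ; 1# = oneS
  ; isCommutativeRing = record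
    { isRing = record
      { +-isAbelianGroup = record
        { isGroup = record
          { isMonoid = record
            { isSemigroup = record
              { isMagma = record
                { isEquivalence = record
                  { refl = mk≈ λ _ _ → ≡.refl
                  ; sym = λ (mk≈ p) → mk≈ λ α l → ≡.sym (p α l)
                  ; trans = λ (mk≈ p) (mk≈ q) → mk≈ λ α l → ≡.trans (p α l) (q α l) }
                ; ∙-cong = λ (mk≈ p) (mk≈ q) → mk≈ λ α l → ≡.cong₂ ℤ._+_ (p α l) (q α l) }
              ; assoc = λ f g h → truncate (+-assoc f g h) }
            ; identity = (λ f → truncate (+-identityˡ f)) , (λ f → truncate (+-identityʳ f)) }
          ; inverse = (λ f → truncate (-‿inverseˡ f)) , (λ f → truncate (-‿inverseʳ f))
          ; ⁻¹-cong = λ (mk≈ p) → mk≈ λ α l → ≡.cong ℤ.-_ (p α l) }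
        ; comm = λ f g → truncate (+-comm f g) }
      ; *-cong = ⊗-cong[]
      ; *-assoc = λ f g h → truncate (*-assoc f g h)
      ; *-identity = (λ f → truncate (*-identityˡ f)) , (λ f → truncate (*-identityʳ f))
      ; distrib = (λ f g h → truncate (distribˡ f g h)) , (λ f g h → truncate (distribʳ f g h)) }
    ; *-comm = λ f g → truncate (*-comm f g) } }
  where
  open IsCommutativeRing (isSerRing n)
  truncate : ∀ {f g} → f ≋ g → f ≈[ d ] g
  truncate (mk≋ p) = mk≈ λ α _ → p α

record Order≥ {n} (k : ℕ) (f : Ser n) : Set where
  constructor mkOrder
  field vanish : ∀ α → deg α < k → f α ≡ 0ℤ

-- If deg β + deg γ < j + k, then deg β < j or deg γ < k, so every term of such a coefficient has a
-- vanishing factor.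
order-⊗ : ∀ {n j k} {f g : Ser n} → Order≥ j f → Order≥ k g → Order≥ (j ℕ.+ k) (f ⊗ g)
order-⊗ {j = j} {k} {f} {g} (mkOrder p) (mkOrder q) = mkOrder λ α α<j+k → sumℤ-zero
  (λ {(β , γ)} eq → zero-term β γ (≡.subst (_< j ℕ.+ k) (≡.sym eq) α<j+k)) (splits-deg α)
  where
  zero-term : ∀ β γ → deg β ℕ.+ deg γ < j ℕ.+ k → f β ℤ.* g γ ≡ 0ℤ
  zero-term β γ lt with deg β ℕ.<? j
  ... | yes β<j = ≡.cong (ℤ._* g γ) (p β β<j)
  ... | no β≮j = ≡.trans (≡.cong (f β ℤ.*_) (q γ
          (ℕ.+-cancelˡ-< j _ _ (ℕ.≤-<-trans (ℕ.+-monoˡ-≤ (deg γ) (ℕ.≮⇒≥ β≮j)) lt)))) (ℤ.*-zeroʳ (f β))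

order-zero : ∀ {n} (f : Ser n) → Order≥ 0 f
order-zero f = mkOrder λ _ ()

order-powS : ∀ {n} {f : Ser n} → Order≥ 1 f → ∀ k → Order≥ k (powS f k)
order-powS p zero = order-zero oneS
order-powS p (suc k) = order-⊗ p (order-powS p k)

order⇒≈0 : ∀ {n d k} {f : Ser n} → Order≥ k f → d < k → f ≈[ d ] zeroS
order⇒≈0 (mkOrder p) d<k = mk≈ λ α α≤d → p α (ℕ.≤-<-trans α≤d d<k)

≈0⇒order : ∀ {n d} {f : Ser n} → f ≈[ d ] zeroS → Order≥ (suc d) f
≈0⇒order (mk≈ p) = mkOrder λ α α≤d → p α (ℕ.≤-pred α≤d)

-- f ≈[ 0 ] oneS says that f has constant term 1.
module _ {n : ℕ} (d : ℕ) {f : Ser n} (unit : f ≈[ 0 ] oneS) where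
  private
    module R = CommutativeRing (truncated n d)
    open module Σ = Iteration R.+-commutativeMonoid using (⨁)

    p : ℕ → Ser n
    p = powS (oneS ⊖ f)

    order : Order≥ 1 (oneS ⊖ f)
    order = ≈0⇒order (Units.one⇒1-a≈0 (truncated n 0) unit)

    ⨁-at : ∀ m (F : ℕ → Ser n) α → ⨁ m F α ≡ ℤ-Sum.⨁ m (λ k → F k α)
    ⨁-at zero F α = ≡.refl
    ⨁-at (suc m) F α = ≡.cong (ℤ._+ F m α) (⨁-at m F α)

    -- `invS` stops its sum at `deg α`, a bound that varies with the coefficient. The `k`-th power
    -- of 1 - f has order at least `k`, so the terms with deg α < k ≤ d vanish at `α` and the bound
    -- can be made uniform.
    invS-geometric : invS f ≈[ d ] ⨁ (suc d) p
    invS-geometric = mk≈ λ α α≤d → begin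
      invS f α
        ≡⟨ ≡.trans (sumS-at (List.map p (upTo (suc (deg α)))) α)
             (ℤ-Sum.fold-map (λ g → g α) p (upTo (suc (deg α)))) ⟩
      sumℤ (List.map (λ k → p k α) (upTo (suc (deg α))))
        ≡⟨ ℤ-Sum.fold-applyUpTo (λ k → p k α) (suc (deg α)) id ⟩
      ℤ-Sum.⨁ (suc (deg α)) (λ k → p k α)
        ≡⟨ ℤ-Sum.⨁-stable (λ k → p k α) (ℕ.≤⇒≤′ (s≤s α≤d))
             (λ k α<k → Order≥.vanish (order-powS order k) α α<k) ⟨
      ℤ-Sum.⨁ (suc d) (λ k → p k α)
        ≡⟨ ⨁-at (suc d) p α ⟨
      ⨁ (suc d) p α ∎
      where open ≡.≡-Reasoning

  -- The product of `f` with the truncated geometric series is 1 minus the power of 1 - f with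
  -- exponent d + 1, and that power has order greater than `d`.
  invS-inverse : f ⊗ invS f ≈[ d ] oneS
  invS-inverse = begin
    f ⊗ invS f          ≈⟨ ⊗-cong[] (R.refl {f}) invS-geometric ⟩
    f ⊗ ⨁ (suc d) p     ≈⟨ Units.geometric-sum (truncated n d) f p R.refl (λ _ → R.refl) (suc d) ⟩
    oneS ⊖ p (suc d)    ≈⟨ R.+-cong (R.refl {oneS}) (R.-‿cong {p (suc d)} {zeroS}
                             (order⇒≈0 (order-powS order (suc d)) (ℕ.n<1+n d))) ⟩
    oneS ⊖ zeroS        ≈⟨ Units.x-0≈x (truncated n d) oneS ⟩
    oneS                ∎
    where open SetoidReasoning R.setoid

-- Words and their decreases

<⇒<ᵇ≡true : ∀ {m n} → m < n → (m ℕ.<ᵇ n) ≡ true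
<⇒<ᵇ≡true = Equivalence.to T-≡ ∘ ℕ.<⇒<ᵇ

≥⇒<ᵇ≡false : ∀ {m n} → n ≤ m → (m ℕ.<ᵇ n) ≡ false
≥⇒<ᵇ≡false {m} {n} n≤m = ¬-not λ eq → ℕ.<⇒≱ (ℕ.<ᵇ⇒< m n (Equivalence.from T-≡ eq)) n≤m

≤⇒≤ᵇ≡true : ∀ {m n} → m ≤ n → (m ℕ.≤ᵇ n) ≡ true
≤⇒≤ᵇ≡true = Equivalence.to T-≡ ∘ ℕ.≤⇒≤ᵇ

>⇒≤ᵇ≡false : ∀ {m n} → n < m → (m ℕ.≤ᵇ n) ≡ false
>⇒≤ᵇ≡false {m} {n} n<m = ¬-not λ eq → ℕ.<⇒≱ n<m (ℕ.≤ᵇ⇒≤ m n (Equivalence.from T-≡ eq))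

≡⇒≡ᵇ≡true : ∀ n → (n ℕ.≡ᵇ n) ≡ true
≡⇒≡ᵇ≡true n = Equivalence.to T-≡ (ℕ.≡⇒≡ᵇ n n ≡.refl)

>⇒≡ᵇ≡false : ∀ {m n} → n < m → (m ℕ.≡ᵇ n) ≡ false
>⇒≡ᵇ≡false {m} {n} n<m = ¬-not λ eq → ℕ.<⇒≢ n<m (≡.sym (ℕ.≡ᵇ⇒≡ m n (Equivalence.from T-≡ eq)))

-- Recurrences on the first letter and the resulting product formula.

-- v b stands for (1 - ξ b)⁻¹.
module DecreaseValues {c ℓ} (R : CommutativeRing c ℓ) (l K : ℕ)
  (ξ η ζ v : ℕ → CommutativeRing.Carrier R) (N L : ℕ)
  where
  open CommutativeRing R
  open SetoidReasoning setoid
  open ℤ-Coefficients R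
  open Vars l K using (isDec; wordsOf; wordsUpTo)
  private
    module Σ = Iteration +-commutativeMonoid
    module Π = Iteration *-commutativeMonoid
  open Σ using () renaming (⨁ to Σ⟨_⟩)
  open Π using () renaming (⨁ to Π⟨_⟩)

  increase : ℕ → ℕ → Carrier
  increase M b = if M ℕ.≤ᵇ b then ζ b else η b

  -- The prefix affects a letter only through its maximum, which decides whether the letter is a
  -- record; so `M` stands for the whole prefix.
  weight : ℕ → List ℕ → Carrier
  weight M [] = 1#
  weight M (a ∷ u) = (if isDec a u then ξ a else increase M a) * weight (M ⊔ a) u

  Q : ℕ → Carrier
  Q zero = 1#
  Q (suc b) = (1# - η b) * (1# - v b * (1# - Q b))

  isDec-< : ∀ {b c} u → c < b → isDec b (c ∷ u) ≡ true
  isDec-< u c<b rewrite <⇒<ᵇ≡true c<b = ≡.refl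

  isDec-≡ : ∀ b u → isDec b (b ∷ u) ≡ isDec b u
  isDec-≡ b u rewrite ≥⇒<ᵇ≡false (ℕ.≤-refl {b}) | ≡⇒≡ᵇ≡true b = ≡.refl

  isDec-> : ∀ {b c} u → b < c → isDec b (c ∷ u) ≡ false
  isDec-> u b<c rewrite ≥⇒<ᵇ≡false (ℕ.<⇒≤ b<c) | >⇒≡ᵇ≡false b<c = ≡.refl

  wsum : ℕ → (List ℕ → Carrier) → Carrier
  wsum zero g = g []
  wsum (suc k) g = Σ⟨ suc N ⟩ (λ c → wsum k (g ∘ (c ∷_)))

  wsum-cong : ∀ k {g h} → (∀ u → length u ≡ k → g u ≈ h u) → wsum k g ≈ wsum k h
  wsum-cong zero eq = eq [] ≡.refl
  wsum-cong (suc k) eq = Σ.⨁-cong (suc N) λ c _ → wsum-cong k λ u p → eq (c ∷ u) (≡.cong suc p)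

  wsum-zero : ∀ k {g} → (∀ u → length u ≡ k → g u ≈ 0#) → wsum k g ≈ 0#
  wsum-zero zero eq = eq [] ≡.refl
  wsum-zero (suc k) eq = Σ.⨁-ε (suc N) λ c _ → wsum-zero k λ u p → eq (c ∷ u) (≡.cong suc p)

  Σ-*ˡ : ∀ n a f → Σ⟨ n ⟩ (λ k → a * f k) ≈ a * Σ⟨ n ⟩ f
  Σ-*ˡ zero a f = sym (zeroʳ a)
  Σ-*ˡ (suc n) a f = trans (+-congʳ (Σ-*ˡ n a f)) (sym (distribˡ _ _ _))

  Σ-linear : ∀ n a b f g → Σ⟨ n ⟩ (λ k → a * f k + b * g k) ≈ a * Σ⟨ n ⟩ f + b * Σ⟨ n ⟩ g
  Σ-linear n a b f g = trans (Σ.⨁-∙ n _ _) (+-cong (Σ-*ˡ n a f) (Σ-*ˡ n b g))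

  wsum-linear : ∀ k a b g h →
    wsum k (λ u → a * g u + b * h u) ≈ a * wsum k g + b * wsum k h
  wsum-linear zero a b g h = refl
  wsum-linear (suc k) a b g h =
    trans (Σ.⨁-cong (suc N) λ c _ → wsum-linear k a b (g ∘ (c ∷_)) (h ∘ (c ∷_)))
      (Σ-linear (suc N) a b _ _)

  W : ℕ → (List ℕ → Carrier) → Carrier
  W k g = Σ⟨ suc k ⟩ (λ j → wsum j g)

  W-cong : ∀ k {g h} → (∀ u → g u ≈ h u) → W k g ≈ W k h
  W-cong k eq = Σ.⨁-cong (suc k) λ j _ → wsum-cong j λ u _ → eq u

  W-linear : ∀ k a b g h → W k (λ u → a * g u + b * h u) ≈ a * W k g + b * W k h
  W-linear k a b g h =
    trans (Σ.⨁-cong (suc k) λ j _ → wsum-linear j a b g h) (Σ-linear (suc k) a b _ _)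

  W-cons : ∀ k g → W (suc k) g ≈ g [] + Σ⟨ suc N ⟩ (λ c → W k (g ∘ (c ∷_)))
  W-cons k g = trans (Σ.⨁-front (suc k) _)
    (+-congˡ (Σ.⨁-swap (suc k) (suc N) λ j c → wsum j (g ∘ (c ∷_))))

  -- When words of length `suc k` contribute nothing, `W k` equals `W (suc k)`, and splitting off a
  -- first letter leaves sums with the same bound `k`. Thus the truncated sums obey closed
  -- equations.
  W-fixpoint : ∀ k {g} → (∀ u → length u ≡ suc k → g u ≈ 0#) →
    W k g ≈ g [] + Σ⟨ suc N ⟩ (λ c → W k (g ∘ (c ∷_)))
  W-fixpoint k {g} vanish = begin
    W k g                      ≈⟨ +-identityʳ _ ⟨
    W k g + 0#                 ≈⟨ +-congˡ (wsum-zero (suc k) vanish) ⟨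
    W (suc k) g                ≈⟨ W-cons k g ⟩
    g [] + Σ⟨ suc N ⟩ (λ c → W k (g ∘ (c ∷_))) ∎

  fold-words : ∀ g k → Σ.fold g (wordsOf N k) ≈ wsum k g
  fold-words g zero = +-identityʳ _
  fold-words g (suc k) = begin
    Σ.fold g (List.concatMap (λ a → List.map (a ∷_) (wordsOf N k)) (upTo (suc N)))
      ≈⟨ Σ.fold-concatMap g (λ a → List.map (a ∷_) (wordsOf N k)) (suc N) ⟩
    Σ⟨ suc N ⟩ (λ a → Σ.fold g (List.map (a ∷_) (wordsOf N k)))
      ≈⟨ Σ.⨁-cong (suc N) (λ a _ →
           trans (reflexive (Σ.fold-map g (a ∷_) (wordsOf N k))) (fold-words (g ∘ (a ∷_)) k)) ⟩
    wsum (suc k) g ∎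

  fold-wordsUpTo : ∀ g k → Σ.fold g (wordsUpTo N k) ≈ W k g
  fold-wordsUpTo g k =
    trans (Σ.fold-concatMap g (wordsOf N) (suc k)) (Σ.⨁-cong (suc k) λ j _ → fold-words g j)

  ifDec : ℕ → (List ℕ → Carrier) → List ℕ → Carrier
  ifDec b g u = if isDec b u then g u else 0#

  module _
    (ξ-unit : ∀ b → (1# - ξ b) * v b ≈ 1#)
    (Q-cancel : ∀ b {x y} → Q b * x ≈ Q b * y → x ≈ y)
    (weight-vanish : ∀ M u → length u ≡ suc L → weight M u ≈ 0#)
    where

    T : ℕ → Carrier
    T M = W L (weight M)

    A : ℕ → ℕ → Carrier
    A M b = W L (weight M ∘ (b ∷_))

    E : ℕ → ℕ → Carrier
    E M b = W L (ifDec b (weight M))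

    P : ℕ → ℕ → Carrier
    P M b = Σ⟨ b ⟩ (A M)

    T-eq : ∀ M → T M ≈ 1# + P M (suc N)
    T-eq M = W-fixpoint L (weight-vanish M)

    -- `E` collects the continuations that make the leading `b` a decrease, with factor `ξ b`; all
    -- others, `T` minus `E`, carry the factor of an increase.
    A-eq : ∀ M b → A M b ≈ (ξ b - increase M b) * E (M ⊔ b) b + increase M b * T (M ⊔ b)
    A-eq M b = trans (W-cong L split) (W-linear L _ _ _ _)
      where
      split : ∀ u → weight M (b ∷ u) ≈
        (ξ b - increase M b) * ifDec b (weight (M ⊔ b)) u + increase M b * weight (M ⊔ b) u
      split u with isDec b u
      ... | true = solve 3 (λ x i w → x :* w := (x :- i) :* w :+ i :* w) refl _ _ _
      ... | false = solve 3 (λ x i w → i :* w := (x :- i) :* con 0ℤ :+ i :* w) refl (ξ b) _ _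

    -- The leading `b` is a decrease when the continuation starts with a smaller letter, or with
    -- another `b` that is itself a decrease. In the second case the repeated letter contributes
    -- `ξ b`, and `b ≤ M` keeps the maximum unchanged.
    E-eq : ∀ {M b} → b ≤ M → b ≤ N → E M b ≈ P M b + ξ b * E M b
    E-eq {M} {b} b≤M b≤N = begin
      E M b
        ≈⟨ W-fixpoint L (λ u p → vanish u (weight-vanish M u p)) ⟩
      0# + Σ⟨ suc N ⟩ F
        ≈⟨ +-identityˡ _ ⟩
      Σ⟨ suc N ⟩ F
        ≈⟨ Σ.⨁-stable F (ℕ.≤⇒≤′ (s≤s b≤N)) (λ c b<c → larger c b<c) ⟩
      Σ⟨ b ⟩ F + F b
        ≈⟨ +-cong (Σ.⨁-cong b λ c c<b → W-cong L λ u →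
             reflexive (≡.cong (if_then weight M (c ∷ u) else 0#) (isDec-< u c<b))) same ⟩
      P M b + ξ b * E M b ∎
      where
      F : ℕ → Carrier
      F c = W L (ifDec b (weight M) ∘ (c ∷_))

      vanish : ∀ u → weight M u ≈ 0# → ifDec b (weight M) u ≈ 0#
      vanish u p with isDec b u
      ... | true = p
      ... | false = refl

      larger : ∀ c → b < c → F c ≈ 0#
      larger c b<c = Σ.⨁-ε (suc L) λ j _ → wsum-zero j λ u _ →
        reflexive (≡.cong (if_then weight M (c ∷ u) else 0#) (isDec-> u b<c))

      -- The summand `0# * 0#` gives the two-term shape required by `W-linear`.
      plateau : ∀ u → ifDec b (weight M) (b ∷ u) ≈ ξ b * ifDec b (weight M) u + 0# * 0#
      plateau u rewrite isDec-≡ b u | ℕ.m≥n⇒m⊔n≡m b≤M with isDec b u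
      ... | true = solve 1 (λ x → x := x :+ con 0ℤ :* con 0ℤ) refl _
      ... | false = solve 1 (λ x → con 0ℤ := x :* con 0ℤ :+ con 0ℤ :* con 0ℤ) refl (ξ b)

      same : F b ≈ ξ b * E M b
      same = trans (W-cong L plateau) (trans (W-linear L (ξ b) 0# _ (λ _ → 0#))
        (solve 2 (λ x y → x :+ con 0ℤ :* y := x) refl _ _))

    E≈vP : ∀ {M b} → b ≤ M → b ≤ N → E M b ≈ v b * P M b
    E≈vP {M} {b} b≤M b≤N = begin
      E M b                                  ≈⟨ *-identityˡ _ ⟨
      1# * E M b                             ≈⟨ *-congʳ (ξ-unit b) ⟨
      (1# - ξ b) * v b * E M b               ≈⟨ solve 3 (λ x v e → (:1 :- x) :* v :* e := v :* (e :- x :* e))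
                                                  refl (ξ b) (v b) (E M b) ⟩
      v b * (E M b - ξ b * E M b)            ≈⟨ *-congˡ (+-congʳ (E-eq b≤M b≤N)) ⟩
      v b * (P M b + ξ b * E M b - ξ b * E M b)
        ≈⟨ solve 3 (λ v p y → v :* (p :+ y :- y) := v :* p) refl (v b) (P M b) (ξ b * E M b) ⟩
      v b * P M b ∎

    -- Mutual induction: `A-closed` at `b` uses `P-eq` at `b`, and `P-eq` at `suc b` adds the words
    -- that begin with `b`. In `A-closed` the case `b = M`, where `b` is a record, is included for
    -- the sake of `U-suc`.
    P-eq : ∀ {M} b → b ≤ M → b ≤ suc N → P M b ≈ (1# - Q b) * T M
    A-closed : ∀ {M b} → b ≤ M → b ≤ N →
      A M b ≈ (ξ b - increase M b) * (v b * ((1# - Q b) * T M)) + increase M b * T M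

    P-eq {M} zero _ _ = solve 1 (λ t → con 0ℤ := (:1 :- :1) :* t) refl (T M)
    P-eq {M} (suc b) b<M b≤N = begin
      P M b + A M b
        ≈⟨ +-cong (P-eq b (ℕ.<⇒≤ b<M) (ℕ.m≤n⇒m≤1+n (ℕ.≤-pred b≤N)))
                  (A-closed (ℕ.<⇒≤ b<M) (ℕ.≤-pred b≤N)) ⟩
      (1# - Q b) * T M + ((ξ b - increase M b) * (v b * ((1# - Q b) * T M)) + increase M b * T M)
        -- Because `b < M`, the letter is not a record and its increase weight is `η b`. The
        -- inserted `1#` is traded for `(1# - ξ b) * v b`, which leaves a polynomial identity.
        ≈⟨ +-cong (sym (*-identityˡ _)) (reflexive (≡.cong
             (λ i → (ξ b - i) * (v b * ((1# - Q b) * T M)) + i * T M)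
             (≡.cong (if_then ζ b else η b) (>⇒≤ᵇ≡false b<M)))) ⟩
      1# * ((1# - Q b) * T M) + ((ξ b - η b) * (v b * ((1# - Q b) * T M)) + η b * T M)
        ≈⟨ +-congʳ (*-congʳ (ξ-unit b)) ⟨
      (1# - ξ b) * v b * ((1# - Q b) * T M) + ((ξ b - η b) * (v b * ((1# - Q b) * T M)) + η b * T M)
        ≈⟨ solve 5 (λ x e v q t → (:1 :- x) :* v :* ((:1 :- q) :* t) :+
                       ((x :- e) :* (v :* ((:1 :- q) :* t)) :+ e :* t)
                     := (:1 :- (:1 :- e) :* (:1 :- v :* (:1 :- q))) :* t)
             refl (ξ b) (η b) (v b) (Q b) (T M) ⟩
      (1# - Q (suc b)) * T M ∎

    A-closed {M} {b} b≤M b≤N = begin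
      A M b
        ≈⟨ A-eq M b ⟩
      (ξ b - increase M b) * E (M ⊔ b) b + increase M b * T (M ⊔ b)
        ≈⟨ reflexive (≡.cong (λ m → (ξ b - increase M b) * E m b + increase M b * T m) (ℕ.m≥n⇒m⊔n≡m b≤M)) ⟩
      (ξ b - increase M b) * E M b + increase M b * T M
        ≈⟨ +-congʳ (*-congˡ (trans (E≈vP b≤M b≤N) (*-congˡ (P-eq b b≤M (ℕ.m≤n⇒m≤1+n b≤N))))) ⟩
      (ξ b - increase M b) * (v b * ((1# - Q b) * T M)) + increase M b * T M ∎

    -- A letter `b ≥ M` is a record and becomes the new maximum, so nothing of `M` remains.
    A-record : ∀ {M} b → M ≤ b → A M b ≈ A b b
    A-record {M} b M≤b = W-cong L λ u → reflexive (≡.cong₂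
      (λ i m → (if isDec b u then ξ b else i) * weight m u)
      (≡.cong (if_then ζ b else η b) (≡.trans (≤⇒≤ᵇ≡true M≤b) (≡.sym (≤⇒≤ᵇ≡true (ℕ.≤-refl {b})))))
      (≡.trans (ℕ.m≤n⇒m⊔n≡n M≤b) (≡.sym (ℕ.⊔-idem b))))

    -- By A-record, A b b = A M b for b ≥ M, so this is T M - P M M.
    U : ℕ → Carrier
    U M = (1# + Σ⟨ suc N ⟩ (λ b → A b b)) - Σ⟨ M ⟩ (λ b → A b b)

    U-eq : ∀ {M} → M ≤ suc N → U M ≈ Q M * T M
    U-eq {M} M≤n = begin
      (1# + D (suc N)) - D M
        -- Adding and subtracting `P M M` produces the crosswise sum to which `⨁-tail-swap` applies.
        ≈⟨ solve 3 (λ x y p → (:1 :+ x) :- y := (:1 :+ (x :+ p)) :- (p :+ y)) refl (D (suc N)) (D M) (P M M) ⟩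
      (1# + (D (suc N) + P M M)) - (P M M + D M)
        ≈⟨ +-congʳ (+-congˡ (Σ.⨁-tail-swap (A M) (λ b → A b b) (ℕ.≤⇒≤′ M≤n) A-record)) ⟨
      (1# + (P M (suc N) + D M)) - (P M M + D M)
        ≈⟨ solve 3 (λ x y p → (:1 :+ (x :+ y)) :- (p :+ y) := (:1 :+ x) :- p) refl (P M (suc N)) (D M) (P M M) ⟩
      (1# + P M (suc N)) - P M M
        ≈⟨ +-cong (sym (T-eq M)) (-‿cong (P-eq M ℕ.≤-refl M≤n)) ⟩
      T M - (1# - Q M) * T M
        ≈⟨ solve 2 (λ q t → t :- (:1 :- q) :* t := q :* t) refl (Q M) (T M) ⟩
      Q M * T M ∎
      where
      D : ℕ → Carrier
      D b = Σ⟨ b ⟩ (λ b → A b b)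

    -- Passing from `M` to `suc M` removes the words that start with `M`; there this letter is a
    -- record, so `ζ M` appears where the recurrence for `Q` has `η M`.
    U-suc : ∀ {M} → M ≤ N → U (suc M) ≈ (1# - ζ M) * (1# - v M * (1# - Q M)) * T M
    U-suc {M} M≤N = begin
      U (suc M)
        ≈⟨ solve 3 (λ g d a → g :- (d :+ a) := (g :- d) :- a) refl _ _ _ ⟩
      U M - A M M
        ≈⟨ +-cong (U-eq (ℕ.m≤n⇒m≤1+n M≤N)) (-‿cong (trans (A-closed ℕ.≤-refl M≤N)
             (reflexive (≡.cong (λ i → (ξ M - i) * (v M * ((1# - Q M) * T M)) + i * T M)
               (≡.cong (if_then ζ M else η M) (≤⇒≤ᵇ≡true (ℕ.≤-refl {M}))))))) ⟩
      Q M * T M - ((ξ M - ζ M) * (v M * ((1# - Q M) * T M)) + ζ M * T M)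
        ≈⟨ +-congʳ (*-congʳ (solve 1 (λ q → q := :1 :- :1 :* (:1 :- q)) refl (Q M))) ⟩
      (1# - 1# * (1# - Q M)) * T M - ((ξ M - ζ M) * (v M * ((1# - Q M) * T M)) + ζ M * T M)
        ≈⟨ +-congʳ (*-congʳ (+-congˡ (-‿cong (*-congʳ (ξ-unit M))))) ⟨
      (1# - (1# - ξ M) * v M * (1# - Q M)) * T M - ((ξ M - ζ M) * (v M * ((1# - Q M) * T M)) + ζ M * T M)
        ≈⟨ solve 5 (λ x z v q t → (:1 :- (:1 :- x) :* v :* (:1 :- q)) :* t :-
                       ((x :- z) :* (v :* ((:1 :- q) :* t)) :+ z :* t)
                     := (:1 :- z) :* (:1 :- v :* (:1 :- q)) :* t)
             refl (ξ M) (ζ M) (v M) (Q M) (T M) ⟩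
      (1# - ζ M) * (1# - v M * (1# - Q M)) * T M ∎

    -- `U-eq` and `U-suc` evaluate `U (suc M)` as (1 - η M) r T(M+1) and as (1 - ζ M) r T(M).
    -- Multiplying the claim by the cancellable `Q (suc M)`, which contains `r`, avoids a separate
    -- division by `r`.
    T-product : ∀ M → M ≤ suc N → T M * Π⟨ M ⟩ (λ b → 1# - η b) ≈ T 0 * Π⟨ M ⟩ (λ b → 1# - ζ b)
    T-product zero _ = refl
    T-product (suc M) M<n = Q-cancel (suc M) (begin
      Q (suc M) * (T (suc M) * (Πη * (1# - η M)))
        ≈⟨ *-assoc _ _ _ ⟨
      Q (suc M) * T (suc M) * (Πη * (1# - η M))
        ≈⟨ *-congʳ (trans (sym (U-eq M<n)) (U-suc (ℕ.≤-pred M<n))) ⟩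
      (1# - ζ M) * r * T M * (Πη * (1# - η M))
        ≈⟨ solve 5 (λ z r t p e → z :* r :* t :* (p :* e) := (z :* r :* e) :* (t :* p)) refl _ r _ _ _ ⟩
      ((1# - ζ M) * r * (1# - η M)) * (T M * Πη)
        ≈⟨ *-congˡ (T-product M (ℕ.<⇒≤ M<n)) ⟩
      ((1# - ζ M) * r * (1# - η M)) * (T 0 * Πζ)
        ≈⟨ solve 5 (λ z r t p e → (z :* r :* e) :* (t :* p) := (e :* r) :* (t :* (p :* z))) refl _ r _ _ _ ⟩
      Q (suc M) * (T 0 * (Πζ * (1# - ζ M))) ∎)
      where
      r Πη Πζ : Carrier
      r = 1# - v M * (1# - Q M)
      Πη = Π⟨ M ⟩ (λ b → 1# - η b)
      Πζ = Π⟨ M ⟩ (λ b → 1# - ζ b)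

    decrease-value-theorem :
      Q (suc N) * (T 0 * Π⟨ suc N ⟩ (λ b → 1# - ζ b)) ≈ Π⟨ suc N ⟩ (λ b → 1# - η b)
    decrease-value-theorem = begin
      Q n * (T 0 * Π⟨ n ⟩ (λ b → 1# - ζ b))  ≈⟨ *-congˡ (T-product n ℕ.≤-refl) ⟨
      Q n * (T n * Π⟨ n ⟩ (λ b → 1# - η b))  ≈⟨ *-assoc _ _ _ ⟨
      Q n * T n * Π⟨ n ⟩ (λ b → 1# - η b)    ≈⟨ *-congʳ (U-eq ℕ.≤-refl) ⟨
      -- No letter exceeds `N`, so `U` at `suc N` retains only the empty word.
      U n * Π⟨ n ⟩ (λ b → 1# - η b)          ≈⟨ *-congʳ (solve 1 (λ d → (:1 :+ d) :- d := :1) refl _) ⟩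
      1# * Π⟨ n ⟩ (λ b → 1# - η b)           ≈⟨ *-identityˡ _ ⟩
      Π⟨ n ⟩ (λ b → 1# - η b)                ∎
      where
      n : ℕ
      n = suc N

-- Solving the recurrence for `Q` block by block.

-- Letters are grouped into blocks: letter i * suc l′ has index i and no s-factor,
-- letter suc m + i * suc l′ with m < l′ has index i and the factor s m.
module Blocks {c ℓ} (R : CommutativeRing c ℓ) (l′ K : ℕ) where
  open CommutativeRing R
  open SetoidReasoning setoid
  open ℤ-Coefficients R
  private
    module Σ = Iteration +-commutativeMonoid
    module Π = Iteration *-commutativeMonoid
    l = suc l′
  open Σ using () renaming (⨁ to Σ⟨_⟩)
  open Π using () renaming (⨁ to Π⟨_⟩)

  Π-inverse : ∀ n {f g} → (∀ k → f k * g k ≈ 1#) → Π⟨ n ⟩ f * Π⟨ n ⟩ g ≈ 1#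
  Π-inverse n {f} {g} inv = trans (sym (Π.⨁-∙ n f g)) (Π.⨁-ε n λ k _ → inv k)

  -- Letters from `K * l` on contribute the factor 1; the `K` complete blocks before them are
  -- regrouped by residue.
  Π-letters : ∀ {x x₀ : ℕ → Carrier} {x₊ : ℕ → ℕ → Carrier} →
    (∀ i → x (i ℕ.* l) ≈ x₀ i) →
    (∀ i {m} → m < l′ → x (suc m ℕ.+ i ℕ.* l) ≈ x₊ m i) →
    (∀ {b} → K ℕ.* l ≤ b → x b ≈ 0#) →
    ∀ {n} → K ℕ.* l ≤ n →
    Π⟨ n ⟩ (λ b → 1# - x b) ≈
      Π⟨ K ⟩ (λ i → 1# - x₀ i) * Π⟨ l′ ⟩ (λ m → Π⟨ K ⟩ (λ i → 1# - x₊ m i))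
  Π-letters {x} {x₀} {x₊} eq₀ eq₊ eq-end {n} Kl≤n = begin
    Π⟨ n ⟩ (λ b → 1# - x b)
      ≈⟨ Π.⨁-stable _ (ℕ.≤⇒≤′ Kl≤n) (λ b Kl≤b →
           trans (+-congˡ (-‿cong (eq-end Kl≤b))) (solve 0 (:1 :- con 0ℤ := :1) refl)) ⟩
    Π⟨ K ℕ.* l ⟩ (λ b → 1# - x b)
      ≈⟨ Π.⨁-blocks l K _ ⟩
    Π⟨ K ⟩ (λ i → Π⟨ l ⟩ (λ m → 1# - x (m ℕ.+ i ℕ.* l)))
      ≈⟨ Π.⨁-cong K (λ i _ → trans (Π.⨁-front l′ _) (*-cong
           (+-congˡ (-‿cong (eq₀ i)))
           (Π.⨁-cong l′ λ m m<l′ → +-congˡ (-‿cong (eq₊ i m<l′))))) ⟩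
    Π⟨ K ⟩ (λ i → (1# - x₀ i) * Π⟨ l′ ⟩ (λ m → 1# - x₊ m i))
      ≈⟨ Π.⨁-∙ K _ _ ⟩
    Π⟨ K ⟩ (λ i → 1# - x₀ i) * Π⟨ K ⟩ (λ i → Π⟨ l′ ⟩ (λ m → 1# - x₊ m i))
      ≈⟨ *-congˡ (Π.⨁-swap K l′ _) ⟩
    Π⟨ K ⟩ (λ i → 1# - x₀ i) * Π⟨ l′ ⟩ (λ m → Π⟨ K ⟩ (λ i → 1# - x₊ m i)) ∎

  module _ (N L : ℕ) (Kl≤N : K ℕ.* l ≤ N) (ξ η ζ v : ℕ → Carrier) (t : Carrier) (s Y : ℕ → Carrier)
    (ξ-unit : ∀ b → (1# - ξ b) * v b ≈ 1#)
    (ξ₀ : ∀ i → ξ (suc i ℕ.* l) ≈ t * Y i)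
    (ξ₊ : ∀ i {m} → m < l′ → ξ (suc m ℕ.+ i ℕ.* l) ≈ s m * Y i)
    (η₀ : ∀ i → η (i ℕ.* l) ≈ Y i)
    (η₊ : ∀ i {m} → m < l′ → η (suc m ℕ.+ i ℕ.* l) ≈ s m * Y i)
    (ξ-end : ∀ {b} → K ℕ.* l < b → ξ b ≈ 0#)
    (η-end : ∀ {b} → K ℕ.* l ≤ b → η b ≈ 0#)
    (H₁ Hₜ : ℕ → Carrier)
    (H₁-inverse : ∀ i → (1# - Y i) * H₁ i ≈ 1#)
    (Hₜ-inverse : ∀ i → (1# - t * Y i) * Hₜ i ≈ 1#)
    where
    open DecreaseValues R l K ξ η ζ v N L

    S : Carrier
    S = Σ⟨ l′ ⟩ s

    -- `Q (suc b)` without its factor `1# - η b`; taken at the multiples of `l`, it satisfies a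
    -- first-order recurrence.
    half-step : ℕ → Carrier
    half-step b = 1# - v b * (1# - Q b)

    half-step-eq : ∀ {a} b → ξ b ≈ a → (1# - a) * half-step b ≈ Q b - a
    half-step-eq {a} b eq = begin
      (1# - a) * (1# - v b * (1# - Q b))
        ≈⟨ solve 3 (λ a v q → (:1 :- a) :* (:1 :- v :* (:1 :- q)) := (:1 :- a) :- (:1 :- a) :* v :* (:1 :- q))
             refl a (v b) (Q b) ⟩
      (1# - a) - (1# - a) * v b * (1# - Q b)
        ≈⟨ +-congˡ (-‿cong (*-congʳ (trans (*-congʳ (+-congˡ (-‿cong (sym eq)))) (ξ-unit b)))) ⟩
      (1# - a) - 1# * (1# - Q b)
        ≈⟨ solve 2 (λ a q → (:1 :- a) :- :1 :* (:1 :- q) := q :- a) refl a (Q b) ⟩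
      Q b - a ∎

    Q-step : ∀ {a} b → ξ b ≈ a → η b ≈ a → Q (suc b) ≈ Q b - a
    Q-step b ξ≈a η≈a = trans (*-congʳ (+-congˡ (-‿cong η≈a))) (half-step-eq b ξ≈a)

    Q-block : ∀ i m → m ≤ l′ →
      Q (suc m ℕ.+ i ℕ.* l) ≈ (1# - Y i) * half-step (i ℕ.* l) - Σ⟨ m ⟩ s * Y i
    Q-block i zero _ = begin
      (1# - η (i ℕ.* l)) * half-step (i ℕ.* l)
        ≈⟨ *-congʳ (+-congˡ (-‿cong (η₀ i))) ⟩
      (1# - Y i) * half-step (i ℕ.* l)
        ≈⟨ solve 2 (λ x y → x := x :- con 0ℤ :* y) refl _ (Y i) ⟩
      (1# - Y i) * half-step (i ℕ.* l) - 0# * Y i ∎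
    Q-block i (suc m) m<l′ = begin
      Q (suc (suc m ℕ.+ i ℕ.* l))
        ≈⟨ Q-step (suc m ℕ.+ i ℕ.* l) (ξ₊ i m<l′) (η₊ i m<l′) ⟩
      Q (suc m ℕ.+ i ℕ.* l) - s m * Y i
        ≈⟨ +-congʳ (Q-block i m (ℕ.<⇒≤ m<l′)) ⟩
      (1# - Y i) * half-step (i ℕ.* l) - Σ⟨ m ⟩ s * Y i - s m * Y i
        ≈⟨ solve 4 (λ x y a b → x :- a :* y :- b :* y := x :- (a :+ b) :* y) refl _ (Y i) _ (s m) ⟩
      (1# - Y i) * half-step (i ℕ.* l) - Σ⟨ suc m ⟩ s * Y i ∎

    -- Write R_i for `half-step (i * l)`. One block gives (1 - t Y_i) R_(i+1) = (1 - Y_i) R_i - (t +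
    -- S) Y_i. Its constant solution is -(t + S)/(1 - t), and the deviation from it is multiplied by
    -- (1 - Y_i)/(1 - t Y_i) in each block. Since R_0 = 1, the initial deviation is (1 + S)/(1 - t);
    -- clearing denominators gives the two products.
    half-step-closed : ∀ i →
      half-step (i ℕ.* l) * (1# - t) * Π⟨ i ⟩ H₁ ≈ (1# + S) * Π⟨ i ⟩ Hₜ - (t + S) * Π⟨ i ⟩ H₁
    half-step-closed zero =
      solve 3 (λ v t s → (:1 :- v :* (:1 :- :1)) :* (:1 :- t) :* :1 := (:1 :+ s) :* :1 :- (t :+ s) :* :1)
        refl (v 0) t S
    half-step-closed (suc i) = begin
      r′ * (1# - t) * (h * H₁ i)
        ≈⟨ *-identityʳ _ ⟨
      r′ * (1# - t) * (h * H₁ i) * 1#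
        -- The factor 1 - t Y_i enters together with its inverse, so that `half-step-eq` applies to
        -- `r′`.
        ≈⟨ *-congˡ (Hₜ-inverse i) ⟨
      r′ * (1# - t) * (h * H₁ i) * ((1# - t * Y i) * Hₜ i)
        ≈⟨ solve 6 (λ r t h a y b → r :* (:1 :- t) :* (h :* a) :* ((:1 :- t :* y) :* b) :=
                       ((:1 :- t :* y) :* r) :* ((:1 :- t) :* (h :* a) :* b)) refl r′ t h (H₁ i) (Y i) (Hₜ i) ⟩
      ((1# - t * Y i) * r′) * ((1# - t) * (h * H₁ i) * Hₜ i)
        ≈⟨ *-congʳ (trans (half-step-eq (suc i ℕ.* l) (ξ₀ i)) (+-congʳ (Q-block i l′ ℕ.≤-refl))) ⟩
      ((1# - Y i) * r - S * Y i - t * Y i) * ((1# - t) * (h * H₁ i) * Hₜ i)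
        ≈⟨ solve 7 (λ y r s t h a b → ((:1 :- y) :* r :- s :* y :- t :* y) :* ((:1 :- t) :* (h :* a) :* b) :=
                       ((:1 :- y) :* a) :* (r :* (:1 :- t) :* h) :* b
                         :- (t :+ s) :* y :* (:1 :- t) :* h :* a :* b)
             refl (Y i) r S t h (H₁ i) (Hₜ i) ⟩
      ((1# - Y i) * H₁ i) * (r * (1# - t) * h) * Hₜ i - (t + S) * Y i * (1# - t) * h * H₁ i * Hₜ i
        ≈⟨ +-congʳ (*-congʳ (trans (*-congʳ (H₁-inverse i)) (trans (*-identityˡ _) (half-step-closed i)))) ⟩
      ((1# + S) * g - (t + S) * h) * Hₜ i - (t + S) * Y i * (1# - t) * h * H₁ i * Hₜ i
        -- Once `h` carries the extra factor (1 - Y_i) `H₁ i`, the terms with `t + S` combine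
        -- through (1 - Y_i) + Y_i (1 - t) = 1 - t Y_i, which `Hₜ i` cancels.
        ≈⟨ +-congʳ (*-congʳ (+-congˡ (-‿cong (*-congˡ (trans (sym (*-identityˡ h)) (*-congʳ (sym (H₁-inverse i)))))))) ⟩
      ((1# + S) * g - (t + S) * ((1# - Y i) * H₁ i * h)) * Hₜ i - (t + S) * Y i * (1# - t) * h * H₁ i * Hₜ i
        ≈⟨ solve 7 (λ y s t h a b g →
             ((:1 :+ s) :* g :- (t :+ s) :* ((:1 :- y) :* a :* h)) :* b :- (t :+ s) :* y :* (:1 :- t) :* h :* a :* b :=
             (:1 :+ s) :* (g :* b) :- (t :+ s) :* (h :* a) :* ((:1 :- t :* y) :* b))
             refl (Y i) S t h (H₁ i) (Hₜ i) g ⟩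
      (1# + S) * (g * Hₜ i) - (t + S) * (h * H₁ i) * ((1# - t * Y i) * Hₜ i)
        ≈⟨ +-congˡ (-‿cong (trans (*-congˡ (Hₜ-inverse i)) (*-identityʳ _))) ⟩
      (1# + S) * (g * Hₜ i) - (t + S) * (h * H₁ i) ∎
      where
      r r′ h g : Carrier
      r = half-step (i ℕ.* l)
      r′ = half-step (suc i ℕ.* l)
      h = Π⟨ i ⟩ H₁
      g = Π⟨ i ⟩ Hₜ

    -- The letter `K * l` has `η` equal to 0 but, for positive `K`, `ξ` equal to t Y_(K-1). Hence
    -- `Q` becomes constant only after this letter.
    Q-end : ∀ {n} → suc (K ℕ.* l) ℕ.≤′ n → Q n ≈ half-step (K ℕ.* l)
    Q-end ℕ.≤′-refl = trans (*-congʳ (+-congˡ (-‿cong (η-end ℕ.≤-refl))))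
      (solve 1 (λ r → (:1 :- con 0ℤ) :* r := r) refl _)
    Q-end (ℕ.≤′-step {n} Kl<n) = trans
      (Q-step n (ξ-end (ℕ.≤′⇒≤ Kl<n)) (η-end (ℕ.<⇒≤ (ℕ.≤′⇒≤ Kl<n))))
      (trans (solve 1 (λ q → q :- con 0ℤ := q) refl _) (Q-end Kl<n))

    denominator-eq : Q (suc N) * (1# - t) * Π⟨ K ⟩ H₁ ≈ (1# + S) * Π⟨ K ⟩ Hₜ - (t + S) * Π⟨ K ⟩ H₁
    denominator-eq = trans (*-congʳ (*-congʳ (Q-end (ℕ.≤⇒≤′ (s≤s Kl≤N))))) (half-step-closed K)

    module _ (r₀ : Carrier) (r₊ : ℕ → Carrier)
      (ζ₀ : ∀ i → ζ (i ℕ.* l) ≈ r₀ * Y i)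
      (ζ₊ : ∀ i {m} → m < l′ → ζ (suc m ℕ.+ i ℕ.* l) ≈ r₊ m * s m * Y i)
      (ζ-end : ∀ {b} → K ℕ.* l ≤ b → ζ b ≈ 0#)
      (H₀ : ℕ → Carrier) (H₊ : ℕ → ℕ → Carrier)
      (H₀-inverse : ∀ i → (1# - r₀ * Y i) * H₀ i ≈ 1#)
      (H₊-inverse : ∀ m i → (1# - r₊ m * s m * Y i) * H₊ m i ≈ 1#)
      (Q-cancel : ∀ b {x y} → Q b * x ≈ Q b * y → x ≈ y)
      (weight-vanish : ∀ M u → length u ≡ suc L → weight M u ≈ 0#)
      where

      -- In the product formula the `ζ` factors are inverted into `H₀` and `H₊`. Among the `η`
      -- factors, those of the letters `i * l` cancel against `H₁`, and the others become the
      -- products E(-s_m Y).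
      words-formula : W L (weight 0) * ((1# + S) * Π⟨ K ⟩ Hₜ - (t + S) * Π⟨ K ⟩ H₁) ≈
        Π⟨ K ⟩ H₀ * (1# - t) *
          Π⟨ l′ ⟩ (λ m → Π⟨ K ⟩ (λ i → 1# + (0# - s m) * Y i) * Π⟨ K ⟩ (H₊ m))
      words-formula = begin
        T₀ * ((1# + S) * Π⟨ K ⟩ Hₜ - (t + S) * Π⟨ K ⟩ H₁)
          ≈⟨ *-congˡ denominator-eq ⟨
        T₀ * (q * (1# - t) * h₁)
          -- The two final factors `1#` are placeholders for the `ζ` factors times their inverses,
          -- first for residue 0, then for the other residues.
          ≈⟨ solve 4 (λ x q t h → x :* (q :* (:1 :- t) :* h) := (q :* x) :* ((:1 :- t) :* h) :* (:1 :* :1))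
               refl T₀ q t h₁ ⟩
        (q * T₀) * ((1# - t) * h₁) * (1# * 1#)
          ≈⟨ *-congˡ (*-cong (Π-inverse K H₀-inverse) (Π-inverse l′ λ m → Π-inverse K (H₊-inverse m))) ⟨
        (q * T₀) * ((1# - t) * h₁) * ((z₀ * h₀) * (z₊ * h₊))
          ≈⟨ solve 8 (λ q x t h a b c d → (q :* x) :* ((:1 :- t) :* h) :* ((a :* b) :* (c :* d)) :=
                         (q :* (x :* (a :* c))) :* ((:1 :- t) :* h :* b :* d))
               refl q T₀ t h₁ z₀ h₀ z₊ h₊ ⟩
        (q * (T₀ * (z₀ * z₊))) * ((1# - t) * h₁ * h₀ * h₊)
          ≈⟨ *-congʳ (*-congˡ (*-congˡ (Π-letters ζ₀ ζ₊ ζ-end Kl≤n))) ⟨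
        (q * (T₀ * Π⟨ suc N ⟩ (λ b → 1# - ζ b))) * ((1# - t) * h₁ * h₀ * h₊)
          ≈⟨ *-congʳ (decrease-value-theorem ξ-unit Q-cancel weight-vanish) ⟩
        Π⟨ suc N ⟩ (λ b → 1# - η b) * ((1# - t) * h₁ * h₀ * h₊)
          ≈⟨ *-congʳ (Π-letters η₀ η₊ η-end Kl≤n) ⟩
        (y₀ * y₊) * ((1# - t) * h₁ * h₀ * h₊)
          ≈⟨ solve 6 (λ a b t h c d → (a :* b) :* ((:1 :- t) :* h :* c :* d) :=
                         (a :* h) :* (c :* (:1 :- t) :* (b :* d)))
               refl y₀ y₊ t h₁ h₀ h₊ ⟩
        (y₀ * h₁) * (h₀ * (1# - t) * (y₊ * h₊))
          ≈⟨ trans (*-congʳ (Π-inverse K H₁-inverse)) (*-identityˡ _) ⟩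
        h₀ * (1# - t) * (y₊ * h₊)
          ≈⟨ *-congˡ (*-congʳ (Π.⨁-cong l′ λ m _ → Π.⨁-cong K λ i _ →
               solve 2 (λ s y → :1 :- s :* y := :1 :+ (con 0ℤ :- s) :* y) refl (s m) (Y i))) ⟩
        h₀ * (1# - t) * (Π⟨ l′ ⟩ (λ m → Π⟨ K ⟩ (λ i → 1# + (0# - s m) * Y i)) * h₊)
          ≈⟨ *-congˡ (Π.⨁-∙ l′ _ _) ⟨
        h₀ * (1# - t) * Π⟨ l′ ⟩ (λ m → Π⟨ K ⟩ (λ i → 1# + (0# - s m) * Y i) * Π⟨ K ⟩ (H₊ m)) ∎
        where
        Kl≤n : K ℕ.* l ≤ suc N
        Kl≤n = ℕ.m≤n⇒m≤1+n Kl≤N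
        T₀ q h₁ z₀ z₊ h₀ h₊ y₀ y₊ : Carrier
        T₀ = W L (weight 0)
        q = Q (suc N)
        h₁ = Π⟨ K ⟩ H₁
        z₀ = Π⟨ K ⟩ (λ i → 1# - r₀ * Y i)
        z₊ = Π⟨ l′ ⟩ (λ m → Π⟨ K ⟩ (λ i → 1# - r₊ m * s m * Y i))
        h₀ = Π⟨ K ⟩ H₀
        h₊ = Π⟨ l′ ⟩ (λ m → Π⟨ K ⟩ (H₊ m))
        y₀ = Π⟨ K ⟩ (λ i → 1# - Y i)
        y₊ = Π⟨ l′ ⟩ (λ m → Π⟨ K ⟩ (λ i → 1# - s m * Y i))

-- The images of the letters

mono≈0 : ∀ {n} (e : Vec ℕ n) → 0 < deg e → mono e ≈[ 0 ] zeroS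
mono≈0 e 0<e = mk≈ vanish
  where
  vanish : ∀ α → deg α ≤ 0 → mono e α ≡ 0ℤ
  vanish α α≤0 with ≡-dec ℕ._≟_ α e
  ... | yes ≡.refl = ⊥-elim (ℕ.<⇒≱ 0<e α≤0)
  ... | no _ = ≡.refl

deg-++ : ∀ {m n} (xs : Vec ℕ m) (ys : Vec ℕ n) → deg ys ≤ deg (xs Vec.++ ys)
deg-++ [] ys = ℕ.≤-refl
deg-++ (x ∷ xs) ys = ℕ.≤-trans (deg-++ xs ys) (ℕ.m≤n+m _ x)

deg-tabulate : ∀ {n} (f : Fin n → ℕ) i → f i ≤ deg (tabulate f)
deg-tabulate f Fin.zero = ℕ.m≤m+n _ _
deg-tabulate f (Fin.suc i) = ℕ.≤-trans (deg-tabulate (f ∘ Fin.suc) i) (ℕ.m≤n+m _ (f Fin.zero))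

deg-unitV : ∀ {m i} → i < m → 0 < deg (unitV m i)
deg-unitV {m} {i} i<m = ℕ.≤-trans (ℕ.≤-reflexive (≡.sym entry)) (deg-tabulate _ (fromℕ< i<m))
  where
  entry : (if toℕ (fromℕ< i<m) ℕ.≡ᵇ i then 1 else 0) ≡ 1
  entry rewrite toℕ-fromℕ< i<m | ≡⇒≡ᵇ≡true i = ≡.refl

⊔-≤ᵇ : ∀ b m a → (b ⊔ m ℕ.≤ᵇ a) ≡ (b ℕ.≤ᵇ a) ∧ (m ℕ.≤ᵇ a)
⊔-≤ᵇ b m a with b ℕ.≤? a | m ℕ.≤? a
... | yes b≤a | yes m≤a
  rewrite ≤⇒≤ᵇ≡true b≤a | ≤⇒≤ᵇ≡true m≤a = ≤⇒≤ᵇ≡true (ℕ.⊔-lub b≤a m≤a)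
... | yes b≤a | no m≰a
  rewrite ≤⇒≤ᵇ≡true b≤a | >⇒≤ᵇ≡false (ℕ.≰⇒> m≰a) =
    >⇒≤ᵇ≡false (ℕ.<-≤-trans (ℕ.≰⇒> m≰a) (ℕ.m≤n⊔m b m))
... | no b≰a | _
  rewrite >⇒≤ᵇ≡false (ℕ.≰⇒> b≰a) =
    >⇒≤ᵇ≡false (ℕ.<-≤-trans (ℕ.≰⇒> b≰a) (ℕ.m≤m⊔n b m))

-- The value 0 for the empty prefix is at most any letter, so a first letter counts as a record.
maximum : List ℕ → ℕ
maximum = List.foldr _⊔_ 0

maximum-∷ʳ : ∀ pre a → maximum (pre ++ [ a ]) ≡ maximum pre ⊔ a
maximum-∷ʳ [] a = ℕ.⊔-identityʳ a
maximum-∷ʳ (b ∷ pre) a =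
  ≡.trans (≡.cong (b ⊔_) (maximum-∷ʳ pre a)) (≡.sym (ℕ.⊔-assoc b (maximum pre) a))

module _ (l′ K : ℕ) where
  private
    l : ℕ
    l = suc l′
  open Vars l K

  residue : ∀ i {m} → m < l → (m ℕ.+ i ℕ.* l) % l ≡ m
  residue i {m} m<l = ≡.trans ([m+kn]%n≡m%n m i l) (m<n⇒m%n≡m m<l)

  quotient : ∀ i {m} → m < l → (m ℕ.+ i ℕ.* l) / l ≡ i
  quotient i {m} m<l = ≡.trans (+-distrib-/-∣ʳ m (divides-refl i))
    (≡.cong₂ ℕ._+_ (m<n⇒m/n≡0 m<l) (m*n/n≡m i l))

  isRec-maximum : ∀ pre a → isRec pre a ≡ (maximum pre ℕ.≤ᵇ a)
  isRec-maximum [] a = ≡.refl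
  isRec-maximum (b ∷ pre) a =
    ≡.trans (≡.cong ((b ℕ.≤ᵇ a) ∧_) (isRec-maximum pre a)) (≡.sym (⊔-≤ᵇ b (maximum pre) a))

  ξ-zero : ∀ i → ξimg (suc i ℕ.* l) ≡ tV ⊗ YV i
  ξ-zero i rewrite residue (suc i) {0} (s≤s z≤n) | quotient (suc i) {0} (s≤s z≤n) = ≡.refl

  ξ-suc : ∀ i {m} → m < l′ → ξimg (suc m ℕ.+ i ℕ.* l) ≡ sV (suc m) ⊗ YV i
  ξ-suc i m<l′ rewrite residue i (s≤s m<l′) | quotient i (s≤s m<l′) = ≡.refl

  η-zero : ∀ i → ηimg (i ℕ.* l) ≡ YV i
  η-zero i rewrite residue i {0} (s≤s z≤n) | quotient i {0} (s≤s z≤n) = ≡.refl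

  η-suc : ∀ i {m} → m < l′ → ηimg (suc m ℕ.+ i ℕ.* l) ≡ sV (suc m) ⊗ YV i
  η-suc i m<l′ rewrite residue i (s≤s m<l′) | quotient i (s≤s m<l′) = ≡.refl

  ζ-zero : ∀ i → ζimg (i ℕ.* l) ≡ rV 0 ⊗ YV i
  ζ-zero i rewrite residue i {0} (s≤s z≤n) | quotient i {0} (s≤s z≤n) = ≡.refl

  ζ-suc : ∀ i {m} → m < l′ → ζimg (suc m ℕ.+ i ℕ.* l) ≡ rV (suc m) ⊗ sV (suc m) ⊗ YV i
  ζ-suc i m<l′ rewrite residue i (s≤s m<l′) | quotient i (s≤s m<l′) = ≡.refl

  -- Every nonzero letter image has a factor `YV i`; its vanishing constant term is what bounds the
  -- length of the words that matter.
  YV≈0 : ∀ i → YV i ≈[ 0 ] zeroS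
  YV≈0 i with i ℕ.<? K
  ... | yes i<K rewrite <⇒<ᵇ≡true i<K = mono≈0 _ (ℕ.≤-trans (deg-unitV i<K)
          (ℕ.≤-trans (deg-++ (zerosV l′) (unitV K i)) (deg-++ (zerosV l) (zerosV l′ Vec.++ unitV K i))))
  ... | no i≮K rewrite ≥⇒<ᵇ≡false (ℕ.≮⇒≥ i≮K) = mk≈ λ _ _ → ≡.refl

  tV≈0 : tV ≈[ 0 ] zeroS
  tV≈0 = mono≈0 _ (s≤s z≤n)

  ⊗YV≈0 : ∀ f i → f ⊗ YV i ≈[ 0 ] zeroS
  ⊗YV≈0 f i = Units.multiple≈0 (truncated _ 0) f (YV≈0 i)

  ξ≈0 : ∀ b → ξimg b ≈[ 0 ] zeroS
  ξ≈0 b with b % l | b / l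
  ... | zero | zero = mk≈ λ _ _ → ≡.refl
  ... | zero | suc i = ⊗YV≈0 tV i
  ... | suc m | i = ⊗YV≈0 (sV (suc m)) i

  η≈0 : ∀ b → ηimg b ≈[ 0 ] zeroS
  η≈0 b with b % l | b / l
  ... | zero | i = YV≈0 i
  ... | suc m | i = ⊗YV≈0 (sV (suc m)) i

  ζ≈0 : ∀ b → ζimg b ≈[ 0 ] zeroS
  ζ≈0 b with b % l | b / l
  ... | zero | i = ⊗YV≈0 (rV 0) i
  ... | suc m | i = ⊗YV≈0 (rV (suc m) ⊗ sV (suc m)) i

  -- The images of the letters modulo degree above `d`, and assembly of the formula.

  module Truncation (d : ℕ) where
    R : CommutativeRing _ _
    R = truncated (NV l K) d
    open CommutativeRing R using (_≈_; refl; sym; trans; reflexive; +-cong; *-cong; -‿cong; *-identityˡ)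
    private
      module R = CommutativeRing R
      module Σ = Iteration R.+-commutativeMonoid
      module Π = Iteration R.*-commutativeMonoid
      module U = Units R
      module U₀ = Units (truncated (NV l K) 0)

    YV-end : ∀ {i} → K ≤ i → YV i ≈ zeroS
    YV-end K≤i rewrite ≥⇒<ᵇ≡false K≤i = refl

    ⊗YV-end : ∀ f {i} → K ≤ i → f ⊗ YV i ≈ zeroS
    ⊗YV-end f K≤i = U.multiple≈0 f (YV-end K≤i)

    index-≥ : ∀ {b} → K ℕ.* l ≤ b → K ≤ b / l
    index-≥ {b} Kl≤b = ≡.subst (_≤ b / l) (m*n/n≡m K l) (/-monoˡ-≤ l Kl≤b)

    -- At residue 0 the image under `ξ` uses the index one lower, so a strict bound on the quotient
    -- is needed to make it vanish.
    index-> : ∀ {b} → K ℕ.* l < b → b % l ≡ 0 → K < b / l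
    index-> {b} Kl<b eq = ℕ.*-cancelʳ-< l K (b / l) (≡.subst (K ℕ.* l <_)
      (≡.trans (m≡m%n+[m/n]*n b l) (≡.cong (ℕ._+ (b / l) ℕ.* l) eq)) Kl<b)

    η-end : ∀ {b} → K ℕ.* l ≤ b → ηimg b ≈ zeroS
    η-end {b} Kl≤b with b % l | b / l | index-≥ {b} Kl≤b
    ... | zero | i | K≤i = YV-end K≤i
    ... | suc m | i | K≤i = ⊗YV-end (sV (suc m)) K≤i

    ζ-end : ∀ {b} → K ℕ.* l ≤ b → ζimg b ≈ zeroS
    ζ-end {b} Kl≤b with b % l | b / l | index-≥ {b} Kl≤b
    ... | zero | i | K≤i = ⊗YV-end (rV 0) K≤i
    ... | suc m | i | K≤i = ⊗YV-end (rV (suc m) ⊗ sV (suc m)) K≤i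

    ξ-end : ∀ {b} → K ℕ.* l < b → ξimg b ≈ zeroS
    ξ-end {b} Kl<b with b % l | b / l | index-≥ {b} (ℕ.<⇒≤ Kl<b) | index-> {b} Kl<b
    ... | zero | zero | _ | _ = refl
    ... | zero | suc i | _ | K<i = ⊗YV-end tV (ℕ.≤-pred (K<i ≡.refl))
    ... | suc m | i | K≤i | _ = ⊗YV-end (sV (suc m)) K≤i

    inverse : ∀ {f : S'} → f ≈[ 0 ] zeroS → (oneS ⊖ f) ⊗ invS (oneS ⊖ f) ≈ oneS
    inverse f≈0 = invS-inverse d (U₀.zero⇒1-a≈1 f≈0)

    v : ℕ → S'
    v b = invS (oneS ⊖ ξimg b)

    h : S' → ℕ → S'
    h c i = invS (oneS ⊖ c ⊗ YV i)

    H-product : ∀ c → H c ≈ Π.⨁ K (h c)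
    H-product c = Π.fold-applyUpTo (h c) K id

    module _ (N L : ℕ) (Kl≤N : K ℕ.* l ≤ N) (d≤L : d ≤ L) where
      open DecreaseValues R l K ξimg ηimg ζimg v N L using (weight; increase; Q; W; W-cong; fold-wordsUpTo)

      ψimg-weight : ∀ pre u → ψimg pre u ≡ weight (maximum pre) u
      ψimg-weight pre [] = ≡.refl
      ψimg-weight pre (a ∷ u) = ≡.cong₂ _⊗_
        (≡.cong (λ r → if isDec a u then ξimg a else (if r then ζimg a else ηimg a)) (isRec-maximum pre a))
        (≡.trans (ψimg-weight (pre ++ [ a ]) u) (≡.cong (λ m → weight m u) (maximum-∷ʳ pre a)))

      LHS-weights : LHS N L ≈ W L (weight 0)
      LHS-weights = trans (fold-wordsUpTo ηψ' L) (W-cong L λ u → reflexive (ψimg-weight [] u))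

      weight-order : ∀ M u → Order≥ (length u) (weight M u)
      weight-order M [] = order-zero oneS
      weight-order M (a ∷ u) = order-⊗ (≈0⇒order letter) (weight-order (M ⊔ a) u)
        where
        letter : (if isDec a u then ξimg a else increase M a) ≈[ 0 ] zeroS
        letter with isDec a u | M ℕ.≤ᵇ a
        ... | true | _ = ξ≈0 a
        ... | false | true = ζ≈0 a
        ... | false | false = η≈0 a

      weight-vanish : ∀ M u → length u ≡ suc L → weight M u ≈ zeroS
      weight-vanish M u eq = order⇒≈0 (weight-order M u)
        (ℕ.≤-<-trans d≤L (ℕ.≤-reflexive (≡.sym eq)))

      -- Constant term 1 makes every `Q b` invertible, which justifies the cancellation in
      -- `T-product`.
      Q≈1 : ∀ b → Q b ≈[ 0 ] oneS
      Q≈1 zero = mk≈ λ _ _ → ≡.refl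
      Q≈1 (suc b) = U₀.Q-step≈1 (η≈0 b)
        (U₀.inverse≈1 (U₀.zero⇒1-a≈1 (ξ≈0 b)) (invS-inverse 0 (U₀.zero⇒1-a≈1 (ξ≈0 b))))
        (Q≈1 b)

      s-sum : sumS-s ≈ Σ.⨁ l′ (sV ∘ suc)
      s-sum = trans (reflexive (Σ.fold-map sV suc (upTo l′))) (Σ.fold-applyUpTo (sV ∘ suc) l′ id)

      factor : ℕ → S'
      factor m = E (zeroS ⊖ sV m) ⊗ H (rV m ⊗ sV m)

      numerator-product : numerator ≈ Π.⨁ K (h (rV 0)) ⊗ (oneS ⊖ tV) ⊗
        Π.⨁ l′ (λ m → Π.⨁ K (λ i → oneS ⊕ (zeroS ⊖ sV (suc m)) ⊗ YV i) ⊗ Π.⨁ K (h (rV (suc m) ⊗ sV (suc m))))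
      numerator-product = *-cong (*-cong (H-product (rV 0)) refl)
        (trans (reflexive (Π.fold-map factor suc (upTo l′)))
        (trans (Π.fold-applyUpTo (factor ∘ suc) l′ id)
          (Π.⨁-cong l′ λ m _ → *-cong (Π.fold-applyUpTo (λ i → oneS ⊕ (zeroS ⊖ sV (suc m)) ⊗ YV i) K id)
            (H-product (rV (suc m) ⊗ sV (suc m))))))

      denominator-product : denominator ≈
        (oneS ⊕ Σ.⨁ l′ (sV ∘ suc)) ⊗ Π.⨁ K (h tV) ⊖ (tV ⊕ Σ.⨁ l′ (sV ∘ suc)) ⊗ Π.⨁ K (h oneS)
      denominator-product = +-cong (*-cong (+-cong (refl {oneS}) s-sum) (H-product tV))
        (-‿cong (*-cong (+-cong (refl {tV}) s-sum) (H-product oneS)))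

      LHS-denominator : LHS N L ⊗ denominator ≈ numerator
      LHS-denominator = trans (*-cong LHS-weights denominator-product) (trans
        (Blocks.words-formula R l′ K N L Kl≤N ξimg ηimg ζimg v tV (sV ∘ suc) YV
          (λ b → inverse (ξ≈0 b))
          (λ i → reflexive (ξ-zero i)) (λ i m<l′ → reflexive (ξ-suc i m<l′))
          (λ i → reflexive (η-zero i)) (λ i m<l′ → reflexive (η-suc i m<l′))
          ξ-end η-end
          (h oneS) (h tV)
          -- The factors of `H oneS` invert `oneS ⊖ oneS ⊗ YV i`, whereas the inverse of 1 - Y_i is
          -- wanted; the unit law bridges the two.
          (λ i → trans (*-cong (+-cong (refl {oneS}) (-‿cong (sym (*-identityˡ (YV i))))) refl)
            (inverse (⊗YV≈0 oneS i)))
          (λ i → inverse (⊗YV≈0 tV i))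
          (rV 0) (rV ∘ suc)
          (λ i → reflexive (ζ-zero i)) (λ i m<l′ → reflexive (ζ-suc i m<l′))
          ζ-end
          (h (rV 0)) (λ m → h (rV (suc m) ⊗ sV (suc m)))
          (λ i → inverse (⊗YV≈0 (rV 0) i))
          (λ m i → inverse (⊗YV≈0 (rV (suc m) ⊗ sV (suc m)) i))
          (λ b → U.cancel (Q b) (invS (Q b)) (invS-inverse d (Q≈1 b)))
          weight-vanish)
        (sym numerator-product))

  H≈1 : ∀ c → H c ≈[ 0 ] oneS
  H≈1 c = trans (H-product c) (Π.⨁-ε K λ i _ →
      Units.inverse≈1 (truncated _ 0) (Units.zero⇒1-a≈1 (truncated _ 0) (⊗YV≈0 c i)) (inverse (⊗YV≈0 c i)))
    where
    open Truncation 0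
    open CommutativeRing R using (trans)
    module Π = Iteration (CommutativeRing.*-commutativeMonoid R)

  -- The degree also counts `t`, so `t` has constant term 0; both `H` products have constant term 1,
  -- and the sums of the s_m cancel. Hence `invS denominator` is a genuine inverse.
  denominator-unit : denominator ≈[ 0 ] oneS
  denominator-unit = Units.denominator≈1 (truncated _ 0) tV≈0 (H≈1 tV) (H≈1 oneS)

theorem3p4 : (l : ℕ) .{{_ : NonZero l}} (K : ℕ) (α : Mono l K) →
    ∃[ N₀ ] ∃[ L₀ ] ((N L : ℕ) → N₀ ≤ N → L₀ ≤ L →
    Vars.LHS l K N L α ≡ Vars.RHS l K α)
-- Letters above `K * l` have image 0, but `K * l` itself can be a decrease of weight t Y_(K-1) and
-- has to lie in the alphabet. Words longer than `deg α` have order above `deg α` and do not reach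
-- this coefficient.
theorem3p4 (suc l′) K α = K ℕ.* suc l′ , deg α , λ N L Kl≤N d≤L →
  _≈[_]_.at (Units.divide (truncated _ (deg α))
    (Vars.LHS (suc l′) K N L) (Vars.numerator (suc l′) K)
    (Vars.denominator (suc l′) K) (invS (Vars.denominator (suc l′) K))
    (invS-inverse (deg α) (denominator-unit l′ K))
    (Truncation.LHS-denominator l′ K (deg α) N L Kl≤N d≤L)) α ℕ.≤-refl
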